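{- For $n\ge 1$, $a_n(21;2\to 3)=\sum_{k=0}^{n}\binom{n}{k}f_{n-k}$, where the sequence $(f_m)_{m\ge 0}$ is defined by $f_m=B_m-\sum_{k=1}^{m}f_{k-1}B_{m-k}$ and $B_m$ is the $m$-th Bell number.
   Context: Standard cycle form of $\sigma\in S_n$: product of disjoint cycles (fixed points included), each cycle starting with its largest element, cycles listed in increasing order of largest elements. The fundamental bijection $\theta:S_n\to S_n$ erases the parentheses of the standard cycle form to give a one-line permutation. For $\pi\in S_n$, $\hat\pi=\theta^{ -1}(\pi)$. An arrow pattern $(\nu;H)$ of size $k$: a string $\nu=a_1\dots a_m$ of positive integers and a set $H$ of arrows $b\to c$, with all integers appearing forming $[k]$. $\pi\in S_n$ contains $(\nu;H)$ if there is $X=\{x_1<\dots<x_k\}\subseteq[n]$ with positions $t_1<\dots<t_m$ such that $\pi_{t_1}\cdots\pi_{t_m}=x_{a_1}\cdots x_{a_m}$ and $\hat\pi(x_b)=x_c$ for every arrow $b\to c\in H$; otherwise it avoids it. $a_n(\nu;H)$ = number of $\pi\in S_n$ avoiding $(\nu;H)$. $B_m$ is the number of set partitions of $[m]$ ($B_0=1$). -}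

module Defs where

open import Data.Nat using (ℕ; zero; suc; _+_; _*_; _∸_; _≤ᵇ_; _<ᵇ_; _≡ᵇ_)
open import Data.Nat.Combinatorics using (_C_)
open import Data.Bool using (Bool; true; false; _∧_; not)
open import Data.List using (List; []; _∷_; map; concatMap; filter; length; upTo; foldr; reverse; zipWith)
open import Data.Bool.ListAction using (any; all)
open import Data.Nat.ListAction using (sum)
open import Data.Integer as ℤ using (ℤ; +_)
open import Relation.Unary using (Pred)
open import Function using (_∘_)

-- Permutations of [n] = {1,…,n} in one-line notation, as lists of ℕ.

range : ℕ → List ℕ
range n = map suc (upTo n)

words : ℕ → ℕ → List (List ℕ)
words n zero    = [] ∷ []
words n (suc k) = concatMap (λ x → map (x ∷_) (words n k)) (range n)

elemᵇ : ℕ → List ℕ → Bool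
elemᵇ x xs = any (_≡ᵇ_ x) xs

distinctᵇ : List ℕ → Bool
distinctᵇ []       = true
distinctᵇ (x ∷ xs) = not (elemᵇ x xs) ∧ distinctᵇ xs

S : ℕ → List (List ℕ)
S n = filter (λ w → distinctᵇ w Data.Bool.≟ true) (words n n)
  where import Data.Bool

-- π(i) for 1 ≤ i ≤ length π  (value 0 outside this range)
app : List ℕ → ℕ → ℕ
app []       _             = 0
app (x ∷ xs) zero          = 0
app (x ∷ xs) (suc zero)    = x
app (x ∷ xs) (suc (suc i)) = app xs (suc i)

-- the cycle of σ through m, listed starting at m:
-- m, σ(m), σ²(m), … up to (not including) the return to m.
-- (fuel = number of further steps allowed; n steps always suffice)
cycleFrom : List ℕ → ℕ → ℕ → ℕ → List ℕ
cycleFrom σ m zero       x = []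
cycleFrom σ m (suc fuel) x with x ≡ᵇ m
... | true  = []
... | false = x ∷ cycleFrom σ m fuel (app σ x)

cycleOf : List ℕ → ℕ → List ℕ
cycleOf σ m = m ∷ cycleFrom σ m (length σ) (app σ m)

isCycleMax : List ℕ → ℕ → Bool
isCycleMax σ m = all (λ y → y ≤ᵇ m) (cycleOf σ m)

standardCycleForm : List ℕ → List (List ℕ)
standardCycleForm σ =
  map (cycleOf σ) (filter (λ m → isCycleMax σ m Data.Bool.≟ true) (range (length σ)))
  where import Data.Bool

θ : List ℕ → List ℕ
θ σ = foldr Data.List._++_ [] (standardCycleForm σ)
  where import Data.List

listEqᵇ : List ℕ → List ℕ → Bool
listEqᵇ []       []       = true
listEqᵇ (x ∷ xs) (y ∷ ys) = (x ≡ᵇ y) ∧ listEqᵇ xs ys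
listEqᵇ _        _        = false

-- Containment of the arrow pattern (21; 2→3) in π ∈ S_n:
-- there are x₁ < x₂ < x₃ in [n] and positions t₁ < t₂ with
-- π(t₁) π(t₂) = x₂ x₁ and π̂(x₂) = x₃, where π̂ = θ⁻¹(π), i.e. π̂ is
-- the (unique) σ ∈ S_n with θ(σ) = π.

contains-21-2→3 : ℕ → List ℕ → Bool
contains-21-2→3 n π =
  any (λ x₁ → any (λ x₂ → any (λ x₃ →
    (x₁ <ᵇ x₂) ∧ (x₂ <ᵇ x₃) ∧
    any (λ t₁ → any (λ t₂ →
      (t₁ <ᵇ t₂) ∧ (app π t₁ ≡ᵇ x₂) ∧ (app π t₂ ≡ᵇ x₁)) (range n)) (range n) ∧
    any (λ σ → listEqᵇ (θ σ) π ∧ (app σ x₂ ≡ᵇ x₃)) (S n))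
    (range n)) (range n)) (range n)

a : ℕ → ℕ
a n = length (filter (λ π → contains-21-2→3 n π Data.Bool.≟ false) (S n))
  where import Data.Bool

bellsRev : ℕ → List ℕ
bellsRev zero    = 1 ∷ []
bellsRev (suc m) = sum (zipWith (λ k b → (m C k) * b) (range′ m) (reverse (bellsRev m))) ∷ bellsRev m
  where
  range′ : ℕ → List ℕ
  range′ m = upTo (suc m)

headOr0 : List ℕ → ℕ
headOr0 []      = 0
headOr0 (x ∷ _) = x

B : ℕ → ℕ
B m = headOr0 (bellsRev m)

fsRev : ℕ → List ℤ
fsRev zero    = + 1 ∷ []
fsRev (suc m) =
  (+ B (suc m)) ℤ.- foldr ℤ._+_ (+ 0)
     (zipWith (λ k fk₋₁ → fk₋₁ ℤ.* (+ B (suc m ∸ k))) (range (suc m)) (reverse (fsRev m)))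
  ∷ fsRev m

headOrZ : List ℤ → ℤ
headOrZ []      = + 0
headOrZ (x ∷ _) = x

f : ℕ → ℤ
f m = headOrZ (fsRev m)

sumTo : ℕ → (ℕ → ℤ) → ℤ
sumTo n g = foldr ℤ._+_ (+ 0) (map g (upTo (suc n)))

{-# OPTIONS --safe #-}
module Submission where

-- If σ = θ⁻¹(π), then σ(x) is the letter after x in π, unless that letter is a left-to-right
-- maximum or does not exist; in these cases σ(x) is the last left-to-right maximum up to x. Hence
-- π avoids (21; 2→3) iff each letter is followed by a smaller one, or is a left-to-right maximum,
-- or is smaller than all later letters. Such words arise uniquely by inserting 1, …, n in this
-- order while keeping track of the number j of gaps in which larger letters are still to come.
-- A new letter opens a gap in 1 way, closes one in j ways, and keeps j in j + 2 ways (1 way if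
-- j = 0), so a n counts weighted lattice paths. Lowering all level weights by 1 inverts a binomial
-- transform. With level weights j + 1 the paths count set partitions; forbidding level steps at
-- height 0 then leads to f, by splitting a path at its first such step.

open import Defs
open import Data.Bool as Bool using (Bool; true; false; T; _∧_)
import Data.Bool.Properties as Bool
open import Data.Bool.ListAction using (any)
open import Data.Empty using (⊥; ⊥-elim)
import Data.Integer.Properties as ℤ
open import Data.List
  using (List; []; _∷_; [_]; _++_; _∷ʳ_; map; concat; concatMap; filter; foldr; length; reverse; upTo;
         zipWith; applyUpTo; applyDownFrom)
open import Data.List.Membership.Propositional using (_∈_; _∉_; find; lose)
open import Data.List.Membership.Propositional.Properties
open import Data.List.Properties hiding (sum-++)
open import Data.List.Relation.Binary.Permutation.Propositional
  using (_↭_; prep; swap; ↭-refl; ↭-sym; ↭-trans; ↭-reflexive; ↭⇒↭ₛ)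
open import Data.List.Relation.Binary.Permutation.Propositional.Properties
  using (All-resp-↭; ∈-resp-↭; shift; drop-∷; ++⁺ˡ; map⁺; ↭-empty-inv; ↭-length; ↭-reverse)
import Data.List.Relation.Binary.Permutation.Setoid.Properties as Permutationₛ
open import Data.List.Relation.Binary.Subset.Propositional using (_⊆_)
open import Data.List.Relation.Unary.All as All using (All; []; _∷_)
import Data.List.Relation.Unary.All.Properties as All
open import Data.List.Relation.Unary.AllPairs as AllPairs using (AllPairs; []; _∷_)
import Data.List.Relation.Unary.AllPairs.Properties as AllPairs
open import Data.List.Relation.Unary.Any as Any using (here; there)
import Data.List.Relation.Unary.Any.Properties as Any
open import Data.List.Relation.Unary.Unique.Propositional using (Unique)
import Data.List.Relation.Unary.Unique.Propositional.Properties as Unique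
open import Data.Maybe as Maybe using (Maybe; just; nothing)
open import Data.Nat as ℕ
  using (ℕ; zero; suc; pred; _∸_; _⊔_; _⊓_; _≤_; _<_; _≡ᵇ_; _<ᵇ_; z≤n; s≤s; z<s; s<s)
open import Data.Nat.Combinatorics using (_C_; nCk≡nC[n∸k]; nCk+nC[k+1]≡[n+1]C[k+1])
open import Data.Nat.Combinatorics.Specification using (k>n⇒nCk≡0)
open import Data.Nat.Induction using (<-rec)
open import Data.Nat.ListAction using (sum)
open import Data.Nat.ListAction.Properties using (sum-++)
open import Data.Nat.Properties
open import Data.Nat.Tactic.RingSolver using (solve-∀)
open import Data.Product as Product using (∃; ∃₂; _×_; _,_; proj₁; proj₂)
open import Data.Sum as Sum using (_⊎_; inj₁; inj₂)
open import Data.Unit using (⊤; tt)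
open import Function using (_∘_; id; const; Equivalence)
open import Relation.Binary.Definitions using (tri<; tri≈; tri>)
open import Relation.Binary.PropositionalEquality
  using (_≡_; _≢_; refl; sym; trans; cong; cong₂; subst; subst₂; setoid; module ≡-Reasoning)
open import Relation.Nullary using (yes; no; ¬_; contradiction)

open Equivalence using (to; from)

-- The weight `j + 2` arises as follows. A new letter exceeds all earlier ones, so it keeps the
-- number of gaps only if it is placed in front of one of the `j` factors that come after a gap (a
-- smaller letter follows it), at the end of the first factor (it is a left-to-right maximum) or at
-- the end of the last factor (no smaller letter comes later). For `j = 0` the first factor is also
-- the last, which leaves 1 way. Bell numbers and `f` enter only through their recurrences. The path
-- identities are proved for every starting height, because an induction on the number of steps
-- leaves height 0. Containment refers to π̂ through a search in `S n` for σ with `θ σ` equal to π.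
-- An explicit right inverse of `θ` is therefore not enough; the uniqueness of σ is obtained from it
-- by finiteness.

module LatticePaths where
  open import Data.Nat using (_+_; _*_)

  -- Finite sums, binomial transforms and weighted lattice paths.

  Σ< : ℕ → (ℕ → ℕ) → ℕ
  Σ< n h = sum (applyUpTo h n)

  Σ<-cong : ∀ n {g h : ℕ → ℕ} → (∀ k → k < n → g k ≡ h k) → Σ< n g ≡ Σ< n h
  Σ<-cong zero    e = refl
  Σ<-cong (suc n) e = cong₂ _+_ (e 0 (s≤s z≤n)) (Σ<-cong n λ k k<n → e (suc k) (s≤s k<n))

  interchange : ∀ a b c d → a + b + (c + d) ≡ a + c + (b + d)
  interchange = solve-∀

  Σ<-+ : ∀ n (g h : ℕ → ℕ) → Σ< n (λ k → g k + h k) ≡ Σ< n g + Σ< n h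
  Σ<-+ zero    g h = refl
  Σ<-+ (suc n) g h = trans (cong (g 0 + h 0 +_) (Σ<-+ n (g ∘ suc) (h ∘ suc)))
                           (interchange (g 0) (h 0) _ _)

  Σ<-* : ∀ n m (h : ℕ → ℕ) → Σ< n (λ k → m * h k) ≡ m * Σ< n h
  Σ<-* zero    m h = sym (*-zeroʳ m)
  Σ<-* (suc n) m h = trans (cong (m * h 0 +_) (Σ<-* n m (h ∘ suc))) (sym (*-distribˡ-+ m (h 0) _))

  Σ<-last : ∀ n (h : ℕ → ℕ) → Σ< (suc n) h ≡ Σ< n h + h n
  Σ<-last zero    h = +-identityʳ (h 0)
  Σ<-last (suc n) h = trans (cong (h 0 +_) (Σ<-last n (h ∘ suc))) (sym (+-assoc (h 0) _ _))

  Σ<-reverse : ∀ n (h : ℕ → ℕ) → Σ< (suc n) (λ k → h (n ∸ k)) ≡ Σ< (suc n) h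
  Σ<-reverse zero    h = refl
  Σ<-reverse (suc n) h = begin
    h (suc n) + Σ< (suc n) (λ k → h (n ∸ k)) ≡⟨ cong (h (suc n) +_) (Σ<-reverse n h) ⟩
    h (suc n) + Σ< (suc n) h                 ≡⟨ +-comm (h (suc n)) _ ⟩
    Σ< (suc n) h + h (suc n)                 ≡⟨ Σ<-last (suc n) h ⟨
    Σ< (suc (suc n)) h                       ∎
    where open ≡-Reasoning

  -- Pascal's rule taken as the definition: raising `n` by one splits off one step, as in the
  -- recursion of `paths`. The usual sum with binomial coefficients is recovered in
  -- `binomialTransform≡Σ`.
  binomialTransform : ℕ → (ℕ → ℕ) → ℕ
  binomialTransform zero    h = h 0
  binomialTransform (suc n) h = binomialTransform n h + binomialTransform n (h ∘ suc)

  binomialTransform-+ : ∀ n (g h : ℕ → ℕ) →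
    binomialTransform n (λ k → g k + h k) ≡ binomialTransform n g + binomialTransform n h
  binomialTransform-+ zero    g h = refl
  binomialTransform-+ (suc n) g h =
    trans (cong₂ _+_ (binomialTransform-+ n g h) (binomialTransform-+ n (g ∘ suc) (h ∘ suc)))
          (interchange (binomialTransform n g) _ _ _)

  binomialTransform-* : ∀ n m (h : ℕ → ℕ) →
    binomialTransform n (λ k → m * h k) ≡ m * binomialTransform n h
  binomialTransform-* zero    m h = refl
  binomialTransform-* (suc n) m h =
    trans (cong₂ _+_ (binomialTransform-* n m h) (binomialTransform-* n m (h ∘ suc)))
          (sym (*-distribˡ-+ m (binomialTransform n h) _))

  binomialTransform≡Σ : ∀ n h → binomialTransform n h ≡ Σ< (suc n) (λ k → (n C k) * h k)
  binomialTransform≡Σ zero    h = lemma (h 0)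
    where
    lemma : ∀ x → x ≡ 1 * x + 0
    lemma = solve-∀
  binomialTransform≡Σ (suc n) h = begin
    binomialTransform n h + binomialTransform n (h ∘ suc)
      ≡⟨ cong₂ _+_ (binomialTransform≡Σ n h) (binomialTransform≡Σ n (h ∘ suc)) ⟩
    (1 * h 0 + Σ< n u) + Σ< (suc n) v
      ≡⟨ cong (λ s → (1 * h 0 + s) + Σ< (suc n) v) (sym Σu) ⟩
    (1 * h 0 + Σ< (suc n) u) + Σ< (suc n) v
      ≡⟨ rearrange (1 * h 0) (Σ< (suc n) u) _ ⟩
    1 * h 0 + (Σ< (suc n) v + Σ< (suc n) u)
      ≡⟨ cong (1 * h 0 +_) (Σ<-+ (suc n) v u) ⟨
    1 * h 0 + Σ< (suc n) (λ k → v k + u k)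
      ≡⟨ cong (1 * h 0 +_) (Σ<-cong (suc n) λ k _ → pascal k) ⟩
    1 * h 0 + Σ< (suc n) (λ k → (suc n C suc k) * h (suc k)) ∎
    where
    open ≡-Reasoning
    u v : ℕ → ℕ
    u k = (n C suc k) * h (suc k)
    v k = (n C k) * h (suc k)
    -- The extra term contains `n C suc n`, which vanishes. It gives both sums the same range, so
    -- that Pascal's rule applies termwise.
    Σu : Σ< (suc n) u ≡ Σ< n u
    Σu = trans (Σ<-last n u)
      (trans (cong (λ c → Σ< n u + c * h (suc n)) (k>n⇒nCk≡0 (n<1+n n))) (+-identityʳ _))
    rearrange : ∀ x y z → x + y + z ≡ x + (z + y)
    rearrange = solve-∀
    pascal : ∀ k → v k + u k ≡ (suc n C suc k) * h (suc k)
    pascal k = trans (sym (*-distribʳ-+ (h (suc k)) (n C k) _))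
                     (cong (_* h (suc k)) (nCk+nC[k+1]≡[n+1]C[k+1] n k))

  -- Weighted count of lattice paths of n steps from height j down to height 0: up steps have
  -- weight 1, a level step at height j has weight c j and a down step from height j has weight j.
  paths : (ℕ → ℕ) → ℕ → ℕ → ℕ
  paths c zero    zero    = 1
  paths c zero    (suc j) = 0
  paths c (suc n) j       = paths c n (suc j) + c j * paths c n j + j * paths c n (pred j)

  -- The additional unit of weight amounts to one new kind of level step at every height. Deleting
  -- the new steps leaves a path of `k` steps with weights `c`, and their positions can be chosen in
  -- `n C k` ways.
  paths-suc : ∀ c n j → paths (suc ∘ c) n j ≡ binomialTransform n (λ k → paths c k j)
  paths-suc c zero    zero    = refl
  paths-suc c zero    (suc j) = refl
  paths-suc c (suc n) j = begin
    paths (suc ∘ c) n (suc j) + suc (c j) * paths (suc ∘ c) n j + j * paths (suc ∘ c) n (pred j)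
      ≡⟨ cong₂ _+_ (cong₂ (λ x y → x + suc (c j) * y) (paths-suc c n (suc j)) (paths-suc c n j))
                   (cong (j *_) (paths-suc c n (pred j))) ⟩
    t (suc j) + suc (c j) * t j + j * t (pred j)
      ≡⟨ rearrange (t (suc j)) (c j) (t j) _ ⟩
    t j + (t (suc j) + c j * t j + j * t (pred j))
      ≡⟨ cong (t j +_) (cong₂ (λ x y → t (suc j) + x + y)
           (binomialTransform-* n (c j) _) (binomialTransform-* n j _)) ⟨
    t j + (t (suc j) + binomialTransform n level + binomialTransform n down)
      ≡⟨ cong (λ x → t j + (x + binomialTransform n down)) (binomialTransform-+ n _ _) ⟨
    t j + (binomialTransform n (λ k → paths c k (suc j) + level k) + binomialTransform n down)
      ≡⟨ cong (t j +_) (binomialTransform-+ n _ _) ⟨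
    t j + binomialTransform n (λ k → paths c (suc k) j) ∎
    where
    open ≡-Reasoning
    t : ℕ → ℕ
    t i = binomialTransform n (λ k → paths c k i)
    level down : ℕ → ℕ
    level k = c j * paths c k j
    down  k = j * paths c k (pred j)
    rearrange : ∀ x a y z → x + suc a * y + z ≡ y + (x + a * y + z)
    rearrange = solve-∀

  -- Adding the values at the heights `suc j` and `j` turns the recursion with level weights `j + 1`
  -- into the one with level weights `j + 2`, and it leaves the values for `n = 0` unchanged. For
  -- `j = 0` the right-hand side is `bellPaths (suc n)`.
  paths-suc-suc : ∀ n j → paths (suc ∘ suc) n j ≡ paths suc n (suc j) + paths suc n j
  paths-suc-suc zero    zero    = refl
  paths-suc-suc zero    (suc j) = refl
  paths-suc-suc (suc n) zero
    rewrite paths-suc-suc n 1 | paths-suc-suc n 0 = identity (paths suc n 2) (paths suc n 1) (paths suc n 0)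
    where
    identity : ∀ x y z → x + y + 2 * (y + z) + 0 ≡ x + 2 * y + 1 * z + (y + 1 * z + 0)
    identity = solve-∀
  paths-suc-suc (suc n) (suc j)
    rewrite paths-suc-suc n (suc (suc j)) | paths-suc-suc n (suc j) | paths-suc-suc n j =
    identity j (paths suc n (suc (suc (suc j)))) (paths suc n (suc (suc j))) (paths suc n (suc j)) (paths suc n j)
    where
    identity : ∀ j x y z w →
      x + y + suc (suc (suc j)) * (y + z) + suc j * (z + w) ≡
      x + suc (suc (suc j)) * y + suc (suc j) * z + (y + suc (suc j) * z + suc j * w)
    identity = solve-∀

  bellPaths : ℕ → ℕ
  bellPaths n = paths suc n 0

  -- This is the recurrence that defines the Bell numbers. The weights `j + 2` stand for a Bell path
  -- with one more step by `paths-suc-suc`, and for a binomial transform by `paths-suc`.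
  bellPaths-suc : ∀ n → bellPaths (suc n) ≡ Σ< (suc n) (λ k → (n C k) * bellPaths k)
  bellPaths-suc n = begin
    paths suc n 1 + 1 * paths suc n 0 + 0 ≡⟨ simplify (paths suc n 1) _ ⟩
    paths suc n 1 + paths suc n 0         ≡⟨ paths-suc-suc n 0 ⟨
    paths (suc ∘ suc) n 0                 ≡⟨ paths-suc suc n 0 ⟩
    binomialTransform n bellPaths         ≡⟨ binomialTransform≡Σ n bellPaths ⟩
    Σ< (suc n) (λ k → (n C k) * bellPaths k) ∎
    where
    open ≡-Reasoning
    simplify : ∀ x y → x + 1 * y + 0 ≡ x + y
    simplify = solve-∀

  -- The weights `j + 1`, except that level steps at height 0 are forbidden. One more than these are
  -- the numbers of insertions that keep the number of gaps: 1 for `j = 0` and `j + 2` otherwise.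
  noGroundLevel : ℕ → ℕ
  noGroundLevel zero    = 0
  noGroundLevel (suc j) = suc (suc j)

  -- Split a path at its first level step at height 0.
  paths-firstGroundLevel : ∀ n j → paths suc n j ≡
    paths noGroundLevel n j + Σ< n (λ k → paths noGroundLevel k j * bellPaths (n ∸ suc k))
  paths-firstGroundLevel zero    zero    = refl
  paths-firstGroundLevel zero    (suc j) = refl
  paths-firstGroundLevel (suc n) j
    rewrite paths-firstGroundLevel n (suc j) | paths-firstGroundLevel n (pred j) = final j
    where
    open ≡-Reasoning
    q : ℕ → ℕ → ℕ
    q = paths noGroundLevel
    s : ℕ → ℕ
    s i = Σ< n (λ k → q k i * bellPaths (n ∸ suc k))
    distribute : ∀ i → s (suc i) + noGroundLevel i * s i + i * s (pred i) ≡
      Σ< n (λ k → q (suc k) i * bellPaths (n ∸ suc k))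
    distribute i = begin
      s (suc i) + noGroundLevel i * s i + i * s (pred i)
        ≡⟨ cong₂ (λ x y → s (suc i) + x + y) (Σ<-* n (noGroundLevel i) _) (Σ<-* n i _) ⟨
      s (suc i) + Σ< n v + Σ< n w
        ≡⟨ cong (_+ Σ< n w) (Σ<-+ n u v) ⟨
      Σ< n (λ k → u k + v k) + Σ< n w
        ≡⟨ Σ<-+ n (λ k → u k + v k) w ⟨
      Σ< n (λ k → u k + v k + w k)
        ≡⟨ Σ<-cong n (λ k _ →
           factor (q k (suc i)) (noGroundLevel i) (q k i) i (q k (pred i)) (bellPaths (n ∸ suc k))) ⟩
      Σ< n (λ k → q (suc k) i * bellPaths (n ∸ suc k)) ∎
      where
      u v w : ℕ → ℕ
      u k = q k (suc i) * bellPaths (n ∸ suc k)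
      v k = noGroundLevel i * (q k i * bellPaths (n ∸ suc k))
      w k = i * (q k (pred i) * bellPaths (n ∸ suc k))
      factor : ∀ x c y i z b → x * b + c * (y * b) + i * (z * b) ≡ (x + c * y + i * z) * b
      factor = solve-∀
    final : ∀ j → (q n (suc j) + s (suc j)) + suc j * paths suc n j + j * (q n (pred j) + s (pred j)) ≡
      q (suc n) j + (q 0 j * bellPaths n + Σ< n (λ k → q (suc k) j * bellPaths (n ∸ suc k)))
    -- Only here do the two level weights differ, 1 against 0. The path that begins with this level
    -- step contributes `bellPaths n`, the term `k = 0` of the sum; at positive heights that term is
    -- zero.
    final zero rewrite sym (distribute 0) =
      identity (q n 1) (s 1) (bellPaths n)
      where
      identity : ∀ x y b → x + y + 1 * b + 0 ≡ x + 0 + 0 + (1 * b + (y + 0 + 0))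
      identity = solve-∀
    final (suc j) rewrite sym (distribute (suc j)) | paths-firstGroundLevel n (suc j) =
      identity j (q n (suc (suc j))) (s (suc (suc j))) (q n (suc j)) (s (suc j)) (q n j) (s j)
      where
      identity : ∀ j a a′ b b′ c c′ →
        a + a′ + suc (suc j) * (b + b′) + suc j * (c + c′) ≡
        a + suc (suc j) * b + suc j * c + (a′ + suc (suc j) * b′ + suc j * c′)
      identity = solve-∀

open LatticePaths

-- The Bell numbers and the sequence `f` as path counts.

module BellTransform where
  open import Data.Integer using (ℤ; +_; -_; _+_; _-_; _*_)
  open ≡-Reasoning

  zipWith-applyUpTo : ∀ {A B C : Set} (g : A → B → C) (u : ℕ → A) (v : ℕ → B) n →
    zipWith g (applyUpTo u n) (applyUpTo v n) ≡ applyUpTo (λ k → g (u k) (v k)) n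
  zipWith-applyUpTo g u v zero    = refl
  zipWith-applyUpTo g u v (suc n) = cong (g (u 0) (v 0) ∷_) (zipWith-applyUpTo g (u ∘ suc) (v ∘ suc) n)

  Σℤ< : ℕ → (ℕ → ℤ) → ℤ
  Σℤ< n h = foldr _+_ (+ 0) (applyUpTo h n)

  Σℤ<-+ : ∀ n {g : ℕ → ℤ} {h : ℕ → ℕ} → (∀ k → k < n → g k ≡ + h k) → Σℤ< n g ≡ + Σ< n h
  Σℤ<-+ zero    e = refl
  Σℤ<-+ (suc n) e = cong₂ _+_ (e 0 (s≤s z≤n)) (Σℤ<-+ n λ k k<n → e (suc k) (s≤s k<n))

  bellsRev≡ : ∀ m → bellsRev m ≡ applyDownFrom B (suc m)
  bellsRev≡ zero    = refl
  bellsRev≡ (suc m) = cong (B (suc m) ∷_) (bellsRev≡ m)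

  B-suc : ∀ m → B (suc m) ≡ Σ< (suc m) (λ k → (m C k) ℕ.* B k)
  B-suc m = cong sum (trans
    (cong (zipWith _ (upTo (suc m))) (trans (cong reverse (bellsRev≡ m)) (reverse-applyDownFrom B (suc m))))
    (zipWith-applyUpTo _ id B (suc m)))

  B≡bellPaths : ∀ m → B m ≡ bellPaths m
  B≡bellPaths = <-rec _ λ where
    zero    ih → refl
    (suc m) ih → trans (B-suc m) (trans
      (Σ<-cong (suc m) λ k k<m → cong ((m C k) ℕ.*_) (ih k<m))
      (sym (bellPaths-suc m)))

  fsRev≡ : ∀ m → fsRev m ≡ applyDownFrom f (suc m)
  fsRev≡ zero    = refl
  fsRev≡ (suc m) = cong (f (suc m) ∷_) (fsRev≡ m)

  f-suc : ∀ m → f (suc m) ≡ + B (suc m) - Σℤ< (suc m) (λ k → f k * + B (m ∸ k))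
  f-suc m = cong (λ ks → + B (suc m) - foldr _+_ (+ 0) ks) (trans
    (cong₂ (zipWith _) (map-upTo suc (suc m)) (trans (cong reverse (fsRev≡ m)) (reverse-applyDownFrom f (suc m))))
    (zipWith-applyUpTo _ suc f (suc m)))

  +-cancel : ∀ x y → + (x ℕ.+ y) - + y ≡ + x
  +-cancel x y = begin
    + x + + y - + y     ≡⟨ ℤ.+-assoc (+ x) (+ y) (- + y) ⟩
    + x + (+ y - + y)   ≡⟨ cong (λ z → + x + z) (ℤ.+-inverseʳ (+ y)) ⟩
    + x + + 0           ≡⟨ ℤ.+-identityʳ (+ x) ⟩
    + x                 ∎

  -- The sum subtracted from `B` in the definition of `f` is the sum in `paths-firstGroundLevel`: it
  -- collects the paths that have a level step at height 0.
  f≡paths : ∀ m → f m ≡ + paths noGroundLevel m 0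
  f≡paths = <-rec _ λ where
    zero    ih → refl
    (suc m) ih → let s = Σ< (suc m) (λ k → paths noGroundLevel k 0 ℕ.* bellPaths (m ∸ k)) in begin
      f (suc m)
        ≡⟨ f-suc m ⟩
      + B (suc m) - Σℤ< (suc m) (λ k → f k * + B (m ∸ k))
        ≡⟨ cong₂ (λ x y → + x - y) (trans (B≡bellPaths (suc m)) (paths-firstGroundLevel (suc m) 0))
             (Σℤ<-+ (suc m) λ k k<m → trans
               (cong₂ (λ x y → x * + y) (ih k<m) (B≡bellPaths (m ∸ k)))
               (sym (ℤ.pos-* (paths noGroundLevel k 0) _))) ⟩
      + (paths noGroundLevel (suc m) 0 ℕ.+ s) - + s
        ≡⟨ +-cancel (paths noGroundLevel (suc m) 0) s ⟩
      + paths noGroundLevel (suc m) 0 ∎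

  sumTo-binomial : ∀ n → sumTo n (λ k → (+ (n C k)) * f (n ∸ k)) ≡ + paths (suc ∘ noGroundLevel) n 0
  sumTo-binomial n = begin
    sumTo n (λ k → (+ (n C k)) * f (n ∸ k))
      ≡⟨ cong (foldr _+_ (+ 0)) (map-upTo (λ k → (+ (n C k)) * f (n ∸ k)) (suc n)) ⟩
    Σℤ< (suc n) (λ k → (+ (n C k)) * f (n ∸ k))
      -- By the symmetry of binomial coefficients the summand depends on `n ∸ k` only, so reversing
      -- the sum brings it into the form of the transform.
      ≡⟨ Σℤ<-+ (suc n) (λ k k≤n → trans
           (cong₂ (λ x y → + x * y) (nCk≡nC[n∸k] (≤-pred k≤n)) (f≡paths (n ∸ k)))
           (sym (ℤ.pos-* (n C (n ∸ k)) _))) ⟩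
    + Σ< (suc n) (λ k → h (n ∸ k))
      ≡⟨ cong (+_) (Σ<-reverse n h) ⟩
    + Σ< (suc n) h
      ≡⟨ cong (+_) (binomialTransform≡Σ n (λ k → paths noGroundLevel k 0)) ⟨
    + binomialTransform n (λ k → paths noGroundLevel k 0)
      ≡⟨ cong (+_) (paths-suc noGroundLevel n 0) ⟨
    + paths (suc ∘ noGroundLevel) n 0 ∎
    where
    h : ℕ → ℕ
    h k = (n C k) ℕ.* paths noGroundLevel k 0

open BellTransform

-- Building the good words by insertion of their letters in increasing order

NextBelow : ℕ → List ℕ → Set
NextBelow x []      = ⊥
NextBelow x (y ∷ _) = y < x

-- The letters r come after w, with a gap in between. The predicate P accumulates the condition of
-- exceeding all letters passed so far: it starts as const ⊤ where left-to-right maxima are allowed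
-- and as Never inside factors that come after a gap.
Good : (ℕ → Set) → List ℕ → List ℕ → Set
Good P []      r = ⊤
Good P (x ∷ w) r =
  (NextBelow x w ⊎ P x ⊎ All (x <_) (w ++ r)) × Good (λ y → P y × x < y) w r

Never : ℕ → Set
Never = const ⊥

module _ where
  private variable
    P Q : ℕ → Set
    X : ℕ
    r r′ : List ℕ

  Good-map : ∀ w → All (λ y → P y → Q y) w → Good P w r → Good Q w r
  Good-map []      _        _       = tt
  Good-map (x ∷ w) (f ∷ fs) (c , g) =
    Sum.map₂ (Sum.map₁ f) c , Good-map w (All.map (λ f (p , x<y) → f p , x<y) fs) g

  Good-later : ∀ w → (∀ {x} → x ∈ w → All (x <_) r → All (x <_) r′) → Good P w r → Good P w r′
  Good-later []      _ _       = tt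
  Good-later (x ∷ w) f (c , g) =
    Sum.map₂ (Sum.map₂ λ x< → All.++⁺ (All.++⁻ˡ w x<) (f (here refl) (All.++⁻ʳ w x<))) c ,
    Good-later w (f ∘ there) g

  Good-later⁺ : ∀ w → All (_< X) w → r′ ↭ X ∷ r → Good P w r → Good P w r′
  Good-later⁺ w w<X p = Good-later w λ x∈w x<r → All-resp-↭ (↭-sym p) (All.lookup w<X x∈w ∷ x<r)

  Good-later⁻ : ∀ w → r′ ↭ X ∷ r → Good P w r′ → Good P w r
  Good-later⁻ w p = Good-later w λ _ x<r′ → All.tail (All-resp-↭ p x<r′)

  insert-↭ : ∀ w v (r : List ℕ) → (w ++ X ∷ v) ++ r ↭ X ∷ w ++ v ++ r
  insert-↭ w v r = ↭-trans (↭-reflexive (++-assoc w _ r)) (shift _ w (v ++ r))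

  -- The last letter of `w` has to be good without help from its successor, which becomes the larger
  -- `X`. No letter of `v` can exceed everything before it once `X` precedes it, which is why `v`
  -- has to be good for `Never`.
  Good-insert : ∀ w v → All (_< X) w → All (_< X) v →
    Good P w (v ++ r) → NextBelow X v ⊎ P X ⊎ All (X <_) (v ++ r) → Good Never v r →
    Good P (w ++ X ∷ v) r
  Good-insert []      v []          v<X _       cX gv = cX , Good-map v (All.map (λ _ ()) v<X) gv
  Good-insert (x ∷ w) v (x<X ∷ w<X) v<X (c , g) cX gv =
    Sum.map (nextBelow w) (Sum.map₂ λ x< → All-resp-↭ (↭-sym (insert-↭ w v _)) (x<X ∷ x<)) c ,
    Good-insert w v w<X v<X g (Sum.map₂ (Sum.map₁ (_, x<X)) cX) gv
    where
    nextBelow : ∀ w → NextBelow x w → NextBelow x (w ++ _ ∷ v)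
    nextBelow (_ ∷ _) y<x = y<x

  Good-delete : ∀ w v → All (_< X) w → All (_< X) v → Good P (w ++ X ∷ v) r →
    Good P w (v ++ r) × (NextBelow X v ⊎ P X ⊎ All (X <_) (v ++ r)) × Good Never v r
  Good-delete []      v []          v<X (cX , g) =
    tt , cX , Good-map v (All.map (λ y<X (_ , X<y) → <-asym y<X X<y) v<X) g
  Good-delete (x ∷ w) v (x<X ∷ w<X) v<X (c , g) with gw , cX , gv ← Good-delete w v w<X v<X g =
    (Sum.map (nextBelow w) (Sum.map₂ λ x< → All.tail (All-resp-↭ (insert-↭ w v _) x<)) c , gw) ,
    Sum.map₂ (Sum.map₁ proj₁) cX , gv
    where
    nextBelow : ∀ w → NextBelow x (w ++ _ ∷ v) → NextBelow x w
    nextBelow []      X<x = <-asym x<X X<x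
    nextBelow (_ ∷ _) y<x = y<x

-- A word being built by inserting its letters in increasing order: the letters inserted so far
-- form factors, and larger letters are still to come in each of the gaps between these factors.
State : Set
State = List ℕ × List (List ℕ)

letters : State → List ℕ
letters (w , ss) = w ++ concat ss

-- The end of a factor is offered only for the last factor. Before a further gap the new letter
-- would have a larger successor, no chance to be a left-to-right maximum, and smaller letters after
-- it. For the same reason a one-letter factor can be created only at the end.
insertOpen : ℕ → List (List ℕ) → List (List (List ℕ))
insertOpen x []           = ([ x ] ∷ []) ∷ []
insertOpen x (s ∷ [])     = ((s ∷ʳ x) ∷ []) ∷ ((x ∷ s) ∷ []) ∷ map (s ∷_) (insertOpen x [])
insertOpen x (s ∷ t ∷ ss) =
  ((s ++ x ∷ t) ∷ ss) ∷ ((x ∷ s) ∷ t ∷ ss) ∷ map (s ∷_) (insertOpen x (t ∷ ss))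

insertMax : ℕ → State → List State
insertMax x (w , [])     = (w ∷ʳ x , []) ∷ map (w ,_) (insertOpen x [])
insertMax x (w , s ∷ ss) =
  (w ∷ʳ x , s ∷ ss) ∷ (w ++ x ∷ s , ss) ∷ map (w ,_) (insertOpen x (s ∷ ss))

-- A larger letter will fill the gap before each of these factors, hence `Never`. Nonemptiness makes
-- the division into factors unique and provides a smaller successor for a letter put in front.
GoodOpen : List (List ℕ) → Set
GoodOpen []       = ⊤
GoodOpen (s ∷ ss) = s ≢ [] × Good Never s (concat ss) × GoodOpen ss

GoodState : State → Set
GoodState (w , ss) = Good (const ⊤) w (concat ss) × GoodOpen ss


module _ {x : ℕ} where

  concat-insertOpen : ∀ ss {ss′} → ss′ ∈ insertOpen x ss → concat ss′ ↭ x ∷ concat ss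
  concat-insertOpen-map : ∀ s ss {ss′} → ss′ ∈ map (s ∷_) (insertOpen x ss) →
    concat ss′ ↭ x ∷ concat (s ∷ ss)

  concat-insertOpen []           (here refl)         = ↭-refl
  concat-insertOpen (s ∷ [])     (here refl)         = insert-↭ s [] []
  concat-insertOpen (s ∷ [])     (there (here refl)) = ↭-refl
  concat-insertOpen (s ∷ [])     (there (there i))   = concat-insertOpen-map s [] i
  concat-insertOpen (s ∷ t ∷ ss) (here refl)         = insert-↭ s t _
  concat-insertOpen (s ∷ t ∷ ss) (there (here refl)) = ↭-refl
  concat-insertOpen (s ∷ t ∷ ss) (there (there i))   = concat-insertOpen-map s (t ∷ ss) i

  concat-insertOpen-map s ss i with _ , j , refl ← ∈-map⁻ (s ∷_) i =
    ↭-trans (++⁺ˡ s (concat-insertOpen ss j)) (shift x s _)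

  letters-insertMax : ∀ s {s′} → s′ ∈ insertMax x s → letters s′ ↭ x ∷ letters s
  letters-insertMax-map : ∀ w ss {s′} → s′ ∈ map (w ,_) (insertOpen x ss) →
    letters s′ ↭ x ∷ w ++ concat ss

  letters-insertMax (w , [])     (here refl)         = insert-↭ w [] []
  letters-insertMax (w , [])     (there i)           = letters-insertMax-map w [] i
  letters-insertMax (w , s ∷ ss) (here refl)         = insert-↭ w [] _
  letters-insertMax (w , s ∷ ss) (there (here refl)) = insert-↭ w s _
  letters-insertMax (w , s ∷ ss) (there (there i))   = letters-insertMax-map w (s ∷ ss) i

  letters-insertMax-map w ss i with _ , j , refl ← ∈-map⁻ (w ,_) i =
    ↭-trans (++⁺ˡ w (concat-insertOpen ss j)) (shift x w _)

  nextBelow-max : ∀ {s} → s ≢ [] → All (_< x) s → NextBelow x s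
  nextBelow-max {[]}    s≢[] _         = s≢[] refl
  nextBelow-max {_ ∷ _} _    (y<x ∷ _) = y<x

  ++∷≢[] : ∀ w {v : List ℕ} → w ++ x ∷ v ≢ []
  ++∷≢[] []      ()
  ++∷≢[] (_ ∷ _) ()

  GoodOpen-insertOpen : ∀ ss {ss′} → All (_< x) (concat ss) → GoodOpen ss →
    ss′ ∈ insertOpen x ss → GoodOpen ss′
  GoodOpen-insertOpen-map : ∀ s ss {ss′} → All (_< x) (s ++ concat ss) → GoodOpen (s ∷ ss) →
    ss′ ∈ map (s ∷_) (insertOpen x ss) → GoodOpen ss′

  GoodOpen-insertOpen [] _ _ (here refl) = (λ ()) , (inj₂ (inj₂ []) , tt) , tt
  GoodOpen-insertOpen (s ∷ []) <x (_ , g , _) (here refl) =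
    ++∷≢[] s , Good-insert s [] (All.++⁻ˡ s <x) [] g (inj₂ (inj₂ [])) tt , tt
  GoodOpen-insertOpen (s ∷ []) <x (s≢[] , g , _) (there (here refl)) =
    (λ ()) , Good-insert [] s [] (All.++⁻ˡ s <x) tt (inj₁ (nextBelow-max s≢[] (All.++⁻ˡ s <x))) g , tt
  GoodOpen-insertOpen (s ∷ []) <x g (there (there i)) = GoodOpen-insertOpen-map s [] <x g i
  GoodOpen-insertOpen (s ∷ t ∷ ss) <x (_ , gs , t≢[] , gt , gss) (here refl) =
    let t<x = All.++⁻ˡ t (All.++⁻ʳ s <x) in
    ++∷≢[] s , Good-insert s t (All.++⁻ˡ s <x) t<x gs (inj₁ (nextBelow-max t≢[] t<x)) gt , gss
  GoodOpen-insertOpen (s ∷ t ∷ ss) <x (s≢[] , gs , g) (there (here refl)) =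
    let s<x = All.++⁻ˡ s <x in
    (λ ()) , Good-insert [] s [] s<x tt (inj₁ (nextBelow-max s≢[] s<x)) gs , g
  GoodOpen-insertOpen (s ∷ t ∷ ss) <x g (there (there i)) = GoodOpen-insertOpen-map s (t ∷ ss) <x g i

  GoodOpen-insertOpen-map s ss <x (s≢[] , gs , g) i with _ , j , refl ← ∈-map⁻ (s ∷_) i =
    s≢[] , Good-later⁺ s (All.++⁻ˡ s <x) (concat-insertOpen ss j) gs ,
    GoodOpen-insertOpen ss (All.++⁻ʳ s <x) g j

  GoodState-insertMax : ∀ s {s′} → All (_< x) (letters s) → GoodState s →
    s′ ∈ insertMax x s → GoodState s′
  GoodState-insertMax-map : ∀ w ss {s′} → All (_< x) (w ++ concat ss) → GoodState (w , ss) →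
    s′ ∈ map (w ,_) (insertOpen x ss) → GoodState s′

  GoodState-insertMax (w , []) <x (gw , gss) (here refl) =
    Good-insert w [] (All.++⁻ˡ w <x) [] gw (inj₂ (inj₁ tt)) tt , gss
  GoodState-insertMax (w , []) <x g (there i) = GoodState-insertMax-map w [] <x g i
  GoodState-insertMax (w , s ∷ ss) <x (gw , gss) (here refl) =
    Good-insert w [] (All.++⁻ˡ w <x) [] gw (inj₂ (inj₁ tt)) tt , gss
  GoodState-insertMax (w , s ∷ ss) <x (gw , _ , gs , gss) (there (here refl)) =
    Good-insert w s (All.++⁻ˡ w <x) (All.++⁻ˡ s (All.++⁻ʳ w <x)) gw (inj₂ (inj₁ tt)) gs , gss
  GoodState-insertMax (w , s ∷ ss) <x g (there (there i)) = GoodState-insertMax-map w (s ∷ ss) <x g i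

  GoodState-insertMax-map w ss <x (gw , gss) i with _ , j , refl ← ∈-map⁻ (w ,_) i =
    Good-later⁺ w (All.++⁻ˡ w <x) (concat-insertOpen ss j) gw ,
    GoodOpen-insertOpen ss (All.++⁻ʳ w <x) gss j

  insertOpen-cons : ∀ s ss {ss′} → ss′ ∈ insertOpen x ss → s ∷ ss′ ∈ insertOpen x (s ∷ ss)
  insertOpen-cons s []      i = there (there (∈-map⁺ (s ∷_) i))
  insertOpen-cons s (_ ∷ _) i = there (there (∈-map⁺ (s ∷_) i))

  insertOpen-front : ∀ s ss → (x ∷ s) ∷ ss ∈ insertOpen x (s ∷ ss)
  insertOpen-front s []      = there (here refl)
  insertOpen-front s (_ ∷ _) = there (here refl)

  insertMax-cons : ∀ w ss {ss′} → ss′ ∈ insertOpen x ss → (w , ss′) ∈ insertMax x (w , ss)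
  insertMax-cons w []      i = there (∈-map⁺ (w ,_) i)
  insertMax-cons w (_ ∷ _) i = there (there (∈-map⁺ (w ,_) i))

  insertMax-back : ∀ w ss → (w ∷ʳ x , ss) ∈ insertMax x (w , ss)
  insertMax-back w []      = here refl
  insertMax-back w (_ ∷ _) = here refl

  HasMax : List ℕ → Set
  HasMax xs = ∃ λ ys → xs ↭ x ∷ ys × All (_< x) ys

  data FindMax (s r : List ℕ) : Set where
    inside  : ∀ u v → s ≡ u ++ x ∷ v → All (_< x) u → All (_< x) v → All (_< x) r → FindMax s r
    outside : All (_< x) s → HasMax r → FindMax s r

  findMax : ∀ s r → HasMax (s ++ r) → FindMax s r
  findMax s r (ys , p , ys<x) with ∈-++⁻ s (∈-resp-↭ (↭-sym p) (here refl))
  ... | inj₁ x∈s with u , v , refl ← ∈-∃++ x∈s =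
    let <x = All-resp-↭ (drop-∷ (↭-trans (↭-sym p) (insert-↭ u v r))) ys<x
    in inside u v refl (All.++⁻ˡ u <x) (All.++⁻ˡ v (All.++⁻ʳ u <x)) (All.++⁻ʳ v (All.++⁻ʳ u <x))
  ... | inj₂ x∈r with u , v , refl ← ∈-∃++ x∈r =
    let <x = All-resp-↭ (drop-∷ (↭-trans (↭-sym p) (↭-trans (++⁺ˡ s (shift x u v)) (shift x s _)))) ys<x
    in outside (All.++⁻ˡ s <x) (_ , shift x u v , All.++⁻ʳ s <x)

  -- Meant for a largest letter `x` that ends its factor: without a successor in the factor it has
  -- to be smaller than everything later, so nothing comes later.
  noLaterOpen : ∀ ss → GoodOpen ss → All (_< x) (concat ss) → Never x ⊎ All (x <_) (concat ss) → ss ≡ []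
  noLaterOpen []             _          _         _               = refl
  noLaterOpen ([] ∷ ss)      (s≢[] , _) _         _               = ⊥-elim (s≢[] refl)
  noLaterOpen ((y ∷ s) ∷ ss) _          (y<x ∷ _) (inj₂ (x<y ∷ _)) = ⊥-elim (<-asym x<y y<x)

  removeOpen : ∀ ss → GoodOpen ss → HasMax (concat ss) → ∃ λ ss₀ → ss ∈ insertOpen x ss₀ × GoodOpen ss₀
  removeOpen []       _ (_ , p , _) with () ← ∈-resp-↭ (↭-sym p) (here refl)
  removeOpen (s ∷ ss) (s≢[] , gs , gss) m with findMax s (concat ss) m
  ... | outside s<x m′ =
    let ss₀ , i , g = removeOpen ss gss m′
    in s ∷ ss₀ , insertOpen-cons s ss₀ i , s≢[] , Good-later⁻ s (concat-insertOpen ss₀ i) gs , g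
  ... | inside u v refl u<x v<x ss<x with Good-delete u v u<x v<x gs
  -- The empty parts tell how `x` came in: both empty, as a new last factor; only `u`, in front of a
  -- factor; only `v`, at the end of the last factor; neither, by closing a gap.
  ...   | gu , cx , gv with u | v
  ...     | []    | [] with refl ← noLaterOpen ss gss ss<x (Sum.fromInj₂ ⊥-elim cx) =
    [] , here refl , tt
  ...     | []    | y ∷ v′ = (y ∷ v′) ∷ ss , insertOpen-front (y ∷ v′) ss , (λ ()) , gv , gss
  ...     | y ∷ u′ | [] with refl ← noLaterOpen ss gss ss<x (Sum.fromInj₂ ⊥-elim cx) =
    (y ∷ u′) ∷ [] , here refl , (λ ()) , gu , tt
  ...     | y ∷ u′ | z ∷ v′ = (y ∷ u′) ∷ (z ∷ v′) ∷ ss , here refl , (λ ()) , gu , (λ ()) , gv , gss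

  removeMax : ∀ s → GoodState s → HasMax (letters s) → ∃ λ s₀ → s ∈ insertMax x s₀ × GoodState s₀
  removeMax (w , ss) (gw , gss) m with findMax w (concat ss) m
  ... | outside w<x m′ =
    let ss₀ , i , g = removeOpen ss gss m′
    in (w , ss₀) , insertMax-cons w ss₀ i , Good-later⁻ w (concat-insertOpen ss₀ i) gw , g
  ... | inside u v refl u<x v<x ss<x with Good-delete u v u<x v<x gw
  ...   | gu , _ , gv with v
  ...     | []     = (u , ss) , insertMax-back u ss , gu , gss
  ...     | y ∷ v′ = (u , (y ∷ v′) ∷ ss) , there (here refl) , gu , (λ ()) , gv , gss

-- No state arises from two different sequences of insertions.

Unique-concatMap : ∀ {A B : Set} (f : A → List B) (g : B → A) xs →
  (∀ {x} → x ∈ xs → Unique (f x)) → (∀ {x y} → x ∈ xs → y ∈ f x → g y ≡ x) →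
  Unique xs → Unique (concatMap f xs)
Unique-concatMap f g []       _ _ _          = []
Unique-concatMap f g (x ∷ xs) u e (x≢ ∷ xs!) = Unique.++⁺ (u (here refl))
  (Unique-concatMap f g xs (u ∘ there) (e ∘ there) xs!)
  -- The retraction `g` recovers the origin of a common element, so lists with different origins are
  -- disjoint.
  λ (y∈fx , y∈fxs) → let x′ , x′∈xs , y∈fx′ = find (∈-concatMap⁻ f {xs = xs} y∈fxs) in
    All.lookup x≢ x′∈xs (trans (sym (e (here refl) y∈fx)) (e (there x′∈xs) y∈fx′))

cut : ℕ → List ℕ → Maybe (List ℕ × List ℕ)
cut x []      = nothing
cut x (y ∷ w) with x ≟ y
... | yes _ = just ([] , w)
... | no  _ = Maybe.map (Product.map₁ (y ∷_)) (cut x w)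

infixr 5 _∷⁺_

-- Dropping empty pieces lets a single rule, cutting at the inserted letter, undo every kind of
-- insertion.
_∷⁺_ : List ℕ → List (List ℕ) → List (List ℕ)
[]      ∷⁺ ss = ss
(x ∷ s) ∷⁺ ss = (x ∷ s) ∷ ss

retractOpen : ℕ → List (List ℕ) → List (List ℕ)
retractOpen x []       = []
retractOpen x (s ∷ ss) with cut x s
... | nothing      = s ∷ retractOpen x ss
... | just (u , v) = u ∷⁺ v ∷⁺ ss

retractMax : ℕ → State → State
retractMax x (w , ss) with cut x w
... | nothing      = w , retractOpen x ss
... | just (u , v) = u , v ∷⁺ ss

∷⁺-nonEmpty : ∀ {s} ss → s ≢ [] → s ∷⁺ ss ≡ s ∷ ss
∷⁺-nonEmpty {[]}    ss s≢[] = ⊥-elim (s≢[] refl)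
∷⁺-nonEmpty {_ ∷ _} ss _    = refl

module _ {x : ℕ} where

  cut-insert : ∀ u v → All (_< x) u → cut x (u ++ x ∷ v) ≡ just (u , v)
  cut-insert []      v [] with x ≟ x
  ... | yes _  = refl
  ... | no x≢x = ⊥-elim (x≢x refl)
  cut-insert (y ∷ u) v (y<x ∷ u<x) with x ≟ y
  ... | yes refl = ⊥-elim (<-irrefl refl y<x)
  ... | no _ rewrite cut-insert u v u<x = refl

  cut-absent : ∀ w → All (_< x) w → cut x w ≡ nothing
  cut-absent []      _ = refl
  cut-absent (y ∷ w) (y<x ∷ w<x) with x ≟ y
  ... | yes refl = ⊥-elim (<-irrefl refl y<x)
  ... | no _ rewrite cut-absent w w<x = refl

  retractOpen-insertOpen : ∀ ss {ss′} → All (_< x) (concat ss) → GoodOpen ss →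
    ss′ ∈ insertOpen x ss → retractOpen x ss′ ≡ ss
  retractOpen-insertOpen-map : ∀ s ss {ss′} → All (_< x) (s ++ concat ss) → GoodOpen (s ∷ ss) →
    ss′ ∈ map (s ∷_) (insertOpen x ss) → retractOpen x ss′ ≡ s ∷ ss

  retractOpen-insertOpen [] _ _ (here refl) rewrite cut-insert [] [] [] = refl
  retractOpen-insertOpen (s ∷ []) <x (s≢[] , _) (here refl)
    rewrite cut-insert s [] (All.++⁻ˡ s <x) = ∷⁺-nonEmpty [] s≢[]
  retractOpen-insertOpen (s ∷ []) <x (s≢[] , _) (there (here refl))
    rewrite cut-insert [] s [] = ∷⁺-nonEmpty [] s≢[]
  retractOpen-insertOpen (s ∷ []) <x g (there (there i)) = retractOpen-insertOpen-map s [] <x g i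
  retractOpen-insertOpen (s ∷ t ∷ ss) <x (s≢[] , _ , t≢[] , _) (here refl)
    rewrite cut-insert s t (All.++⁻ˡ s <x) | ∷⁺-nonEmpty ss t≢[] = ∷⁺-nonEmpty (t ∷ ss) s≢[]
  retractOpen-insertOpen (s ∷ t ∷ ss) <x (s≢[] , _) (there (here refl))
    rewrite cut-insert [] s [] = ∷⁺-nonEmpty (t ∷ ss) s≢[]
  retractOpen-insertOpen (s ∷ t ∷ ss) <x g (there (there i)) = retractOpen-insertOpen-map s (t ∷ ss) <x g i

  retractOpen-insertOpen-map s ss <x (_ , _ , g) i with _ , j , refl ← ∈-map⁻ (s ∷_) i
    rewrite cut-absent s (All.++⁻ˡ s <x) = cong (s ∷_) (retractOpen-insertOpen ss (All.++⁻ʳ s <x) g j)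

  retractMax-insertMax : ∀ s {s′} → All (_< x) (letters s) → GoodState s →
    s′ ∈ insertMax x s → retractMax x s′ ≡ s
  retractMax-insertMax-map : ∀ w ss {s′} → All (_< x) (w ++ concat ss) → GoodState (w , ss) →
    s′ ∈ map (w ,_) (insertOpen x ss) → retractMax x s′ ≡ (w , ss)

  retractMax-insertMax (w , []) <x g (here refl) rewrite cut-insert w [] (All.++⁻ˡ w <x) = refl
  retractMax-insertMax (w , []) <x g (there i) = retractMax-insertMax-map w [] <x g i
  retractMax-insertMax (w , s ∷ ss) <x g (here refl) rewrite cut-insert w [] (All.++⁻ˡ w <x) = refl
  retractMax-insertMax (w , s ∷ ss) <x (_ , s≢[] , _) (there (here refl))
    rewrite cut-insert w s (All.++⁻ˡ w <x) = cong (w ,_) (∷⁺-nonEmpty ss s≢[])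
  retractMax-insertMax (w , s ∷ ss) <x g (there (there i)) = retractMax-insertMax-map w (s ∷ ss) <x g i

  retractMax-insertMax-map w ss <x (_ , g) i with _ , j , refl ← ∈-map⁻ (w ,_) i
    rewrite cut-absent w (All.++⁻ˡ w <x) = cong (w ,_) (retractOpen-insertOpen ss (All.++⁻ʳ w <x) g j)

  insert≢ : ∀ (w : List ℕ) {v} → w ++ x ∷ v ≢ w
  insert≢ w eq with () ← ++-identityʳ-unique w (sym eq)

  Unique-insertOpen : ∀ ss → All (_< x) (concat ss) → GoodOpen ss → Unique (insertOpen x ss)
  Unique-insertOpen-map : ∀ s ss → All (_< x) (s ++ concat ss) → GoodOpen (s ∷ ss) →
    Unique (map (s ∷_) (insertOpen x ss))

  ∷≢map : ∀ {s s′} {ss} sss → s′ ≢ s → All (s′ ∷ ss ≢_) (map (s ∷_) sss)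
  ∷≢map sss s′≢s = All.map⁺ (All.universal (λ _ eq → s′≢s (∷-injectiveˡ eq)) sss)

  Unique-insertOpen [] _ _ = [] ∷ []
  Unique-insertOpen (s ∷ []) <x g@(s≢[] , _) =
    (differ s s≢[] (All.++⁻ˡ s <x) ∘ ∷-injectiveˡ ∷ ∷≢map (insertOpen x []) (insert≢ s)) ∷
    ∷≢map (insertOpen x []) (1+n≢n ∘ cong length) ∷
    Unique-insertOpen-map s [] <x g
    where
    differ : ∀ s → s ≢ [] → All (_< x) s → s ∷ʳ x ≢ x ∷ s
    differ []      s≢[] _         _  = s≢[] refl
    differ (_ ∷ _) _    (y<x ∷ _) eq = <-irrefl (∷-injectiveˡ eq) y<x
  Unique-insertOpen (s ∷ t ∷ ss) <x g =
    ((λ eq → 1+n≢n (sym (cong length eq))) ∷ ∷≢map (insertOpen x (t ∷ ss)) (insert≢ s)) ∷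
    ∷≢map (insertOpen x (t ∷ ss)) (1+n≢n ∘ cong length) ∷
    Unique-insertOpen-map s (t ∷ ss) <x g

  Unique-insertOpen-map s ss <x (_ , _ , g) =
    Unique.map⁺ (λ { refl → refl }) (Unique-insertOpen ss (All.++⁻ʳ s <x) g)

  Unique-insertMax : ∀ s → All (_< x) (letters s) → GoodState s → Unique (insertMax x s)
  Unique-insertMax (w , ss) <x (_ , g) = go ss (All.++⁻ʳ w <x) g
    where
    Unique-map : ∀ ss → All (_< x) (concat ss) → GoodOpen ss → Unique (map (w ,_) (insertOpen x ss))
    Unique-map ss <x g = Unique.map⁺ (λ { refl → refl }) (Unique-insertOpen ss <x g)
    ,≢map : ∀ {v ss} sss → All ((w ++ x ∷ v , ss) ≢_) (map (w ,_) sss)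
    ,≢map sss = All.map⁺ (All.universal (λ _ eq → insert≢ w (cong proj₁ eq)) sss)
    go : ∀ ss → All (_< x) (concat ss) → GoodOpen ss → Unique (insertMax x (w , ss))
    go []       <x g = ,≢map (insertOpen x []) ∷ Unique-map [] <x g
    go (s ∷ ss) <x g =
      ((λ eq → 1+n≢n (cong (length ∘ proj₂) eq)) ∷ ,≢map (insertOpen x (s ∷ ss))) ∷
      ,≢map (insertOpen x (s ∷ ss)) ∷
      Unique-map (s ∷ ss) <x g

states : ℕ → List State
states zero    = ([] , []) ∷ []
states (suc t) = concatMap (insertMax (suc t)) (states t)


letters<max : ∀ t {w} → w ↭ applyDownFrom suc t → All (_< suc t) w
letters<max t p = All-resp-↭ (↭-sym p) (All.applyDownFrom⁺₁ suc t s≤s)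

∈-states⁻ : ∀ t {s} → s ∈ states t → GoodState s × letters s ↭ applyDownFrom suc t
∈-states⁻ zero    (here refl) = (tt , tt) , ↭-refl
∈-states⁻ (suc t) s′∈
  with s , s∈ , i ← find (∈-concatMap⁻ (insertMax (suc t)) {xs = states t} s′∈)
  with g , p ← ∈-states⁻ t s∈ =
  GoodState-insertMax s (letters<max t p) g i , ↭-trans (letters-insertMax s i) (prep _ p)

∈-states⁺ : ∀ t s → GoodState s → letters s ↭ applyDownFrom suc t → s ∈ states t
∈-states⁺ zero    ([] , [])           _ _ = here refl
∈-states⁺ zero    ([] , [] ∷ ss)      (_ , s≢[] , _) _ = ⊥-elim (s≢[] refl)
∈-states⁺ zero    ([] , (y ∷ s) ∷ ss) _ p with () ← ↭-empty-inv p
∈-states⁺ zero    (y ∷ w , ss)        _ p with () ← ↭-empty-inv p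
∈-states⁺ (suc t) s g p =
  let s₀ , i , g₀ = removeMax s g (_ , p , All.applyDownFrom⁺₁ suc t s≤s)
  in ∈-concatMap⁺ (insertMax (suc t))
       (lose (∈-states⁺ t s₀ g₀ (drop-∷ (↭-trans (↭-sym (letters-insertMax s₀ i)) p))) i)

Unique-states : ∀ t → Unique (states t)
Unique-states zero    = [] ∷ []
Unique-states (suc t) = Unique-concatMap (insertMax (suc t)) (retractMax (suc t)) (states t)
  (λ {s} s∈ → let g , p = ∈-states⁻ t s∈ in Unique-insertMax s (letters<max t p) g)
  (λ {s} s∈ i → let g , p = ∈-states⁻ t s∈ in retractMax-insertMax s (letters<max t p) g i)
  (Unique-states t)

-- Counting states by weighted paths.

module WeightedCount where
  open import Data.Nat using (_+_; _*_)

  sum-concatMap : ∀ {A B : Set} (h : B → ℕ) (f : A → List B) xs →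
    sum (map h (concatMap f xs)) ≡ sum (map (λ x → sum (map h (f x))) xs)
  sum-concatMap h f []       = refl
  sum-concatMap h f (x ∷ xs) = begin
    sum (map h (f x ++ concatMap f xs))             ≡⟨ cong sum (map-++ h (f x) _) ⟩
    sum (map h (f x) ++ map h (concatMap f xs))     ≡⟨ sum-++ (map h (f x)) _ ⟩
    sum (map h (f x)) + sum (map h (concatMap f xs)) ≡⟨ cong (sum (map h (f x)) +_) (sum-concatMap h f xs) ⟩
    sum (map h (f x)) + sum (map (λ x → sum (map h (f x))) xs) ∎
    where open ≡-Reasoning

  openCount : State → ℕ
  openCount (_ , ss) = length ss

  module _ (x : ℕ) where

    -- With `suc i` gaps this is one level step and one down step short of the recursion of `paths`.
    -- The two missing ways involve the factor before the first gap and are added in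
    -- `sum-insertMax`.
    sum-insertOpen-∷ : ∀ (h : ℕ → ℕ) s ss → let i = length ss in
      sum (map (h ∘ length) (insertOpen x (s ∷ ss))) ≡
      h (suc (suc i)) + suc (suc i) * h (suc i) + i * h i
    sum-insertOpen-∷ h s [] = identity (h 1) (h 2)
      where
      identity : ∀ a b → a + (a + (b + 0)) ≡ b + 2 * a + 0
      identity = solve-∀
    sum-insertOpen-∷ h s (t ∷ ss) = begin
      h i + (h (suc i) + sum (map (h ∘ length) (map (s ∷_) (insertOpen x (t ∷ ss)))))
        ≡⟨ cong (λ l → h i + (h (suc i) + sum l)) (map-∘ (insertOpen x (t ∷ ss))) ⟨
      h i + (h (suc i) + sum (map (h ∘ suc ∘ length) (insertOpen x (t ∷ ss))))
        ≡⟨ cong (λ r → h i + (h (suc i) + r)) (sum-insertOpen-∷ (h ∘ suc) t ss) ⟩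
      h i + (h (suc i) + (h (suc (suc i)) + suc i * h (suc i) + length ss * h i))
        ≡⟨ identity (length ss) (h i) (h (suc i)) (h (suc (suc i))) ⟩
      h (suc (suc i)) + suc (suc i) * h (suc i) + i * h i ∎
      where
      open ≡-Reasoning
      i : ℕ
      i = suc (length ss)
      identity : ∀ k a b c → a + (b + (c + suc (suc k) * b + k * a)) ≡ c + suc (suc (suc k)) * b + suc k * a
      identity = solve-∀

    sum-insertMax : ∀ n s → sum (map (paths (suc ∘ noGroundLevel) n ∘ openCount) (insertMax x s)) ≡
      paths (suc ∘ noGroundLevel) (suc n) (openCount s)
    sum-insertMax n (w , []) = identity (paths _ n 0) (paths _ n 1)
      where
      identity : ∀ a b → a + (b + 0) ≡ b + 1 * a + 0
      identity = solve-∀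
    sum-insertMax n (w , s ∷ ss) = begin
      h (suc i) + (h i + sum (map (h ∘ openCount) (map (w ,_) (insertOpen x (s ∷ ss)))))
        ≡⟨ cong (λ l → h (suc i) + (h i + sum l)) (map-∘ (insertOpen x (s ∷ ss))) ⟨
      h (suc i) + (h i + sum (map (h ∘ length) (insertOpen x (s ∷ ss))))
        ≡⟨ cong (λ r → h (suc i) + (h i + r)) (sum-insertOpen-∷ h s ss) ⟩
      h (suc i) + (h i + (h (suc (suc i)) + suc (suc i) * h (suc i) + i * h i))
        ≡⟨ identity i (h i) (h (suc i)) (h (suc (suc i))) ⟩
      h (suc (suc i)) + suc (suc (suc i)) * h (suc i) + suc i * h i ∎
      where
      open ≡-Reasoning
      i : ℕ
      i = length ss
      h : ℕ → ℕ
      h = paths (suc ∘ noGroundLevel) n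
      identity : ∀ k a b c → b + (a + (c + suc (suc k) * b + k * a)) ≡ c + suc (suc (suc k)) * b + suc k * a
      identity = solve-∀

  -- Each state is weighted by the number of ways to close all its gaps with `n` further letters.
  -- Inserting one letter moves a unit from `n` to `t` and preserves the total.
  sum-states : ∀ t n → sum (map (paths (suc ∘ noGroundLevel) n ∘ openCount) (states t)) ≡
    paths (suc ∘ noGroundLevel) (t + n) 0
  sum-states zero    n = +-identityʳ _
  sum-states (suc t) n = begin
    sum (map (h n) (concatMap (insertMax (suc t)) (states t)))
      ≡⟨ sum-concatMap (h n) (insertMax (suc t)) (states t) ⟩
    sum (map (λ s → sum (map (h n) (insertMax (suc t) s))) (states t))
      ≡⟨ cong sum (map-cong (sum-insertMax (suc t) n) (states t)) ⟩
    sum (map (h (suc n)) (states t))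
      ≡⟨ sum-states t (suc n) ⟩
    paths (suc ∘ noGroundLevel) (t + suc n) 0
      ≡⟨ cong (λ m → paths (suc ∘ noGroundLevel) m 0) (+-suc t n) ⟩
    paths (suc ∘ noGroundLevel) (suc t + n) 0 ∎
    where
    open ≡-Reasoning
    h : ℕ → State → ℕ
    h m = paths (suc ∘ noGroundLevel) m ∘ openCount

open WeightedCount

closedWords : List State → List (List ℕ)
closedWords []                  = []
closedWords ((w , [])    ∷ sss) = w ∷ closedWords sss
closedWords ((w , _ ∷ _) ∷ sss) = closedWords sss

∈-closedWords⁺ : ∀ {w} sss → (w , []) ∈ sss → w ∈ closedWords sss
∈-closedWords⁺ (_ ∷ sss)           (here refl) = here refl
∈-closedWords⁺ ((_ , [])    ∷ sss) (there i)   = there (∈-closedWords⁺ sss i)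
∈-closedWords⁺ ((_ , _ ∷ _) ∷ sss) (there i)   = ∈-closedWords⁺ sss i

∈-closedWords⁻ : ∀ {w} sss → w ∈ closedWords sss → (w , []) ∈ sss
∈-closedWords⁻ ((_ , [])    ∷ sss) (here refl) = here refl
∈-closedWords⁻ ((_ , [])    ∷ sss) (there i)   = there (∈-closedWords⁻ sss i)
∈-closedWords⁻ ((_ , _ ∷ _) ∷ sss) i           = there (∈-closedWords⁻ sss i)

Unique-closedWords : ∀ sss → Unique sss → Unique (closedWords sss)
Unique-closedWords []                  _          = []
Unique-closedWords ((w , [])    ∷ sss) (w≢ ∷ !) =
  All.tabulate (λ i eq → All.lookup w≢ (∈-closedWords⁻ sss i) (cong (_, []) eq)) ∷ Unique-closedWords sss !
Unique-closedWords ((_ , _ ∷ _) ∷ sss) (_ ∷ !)    = Unique-closedWords sss !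

-- With no steps left, `paths c 0` is the indicator of height 0, whatever the weights `c`.
length-closedWords : ∀ c sss → length (closedWords sss) ≡ sum (map (paths c 0 ∘ openCount) sss)
length-closedWords c []                  = refl
length-closedWords c ((_ , [])    ∷ sss) = cong suc (length-closedWords c sss)
length-closedWords c ((_ , _ ∷ _) ∷ sss) = length-closedWords c sss

goodWords : ℕ → List (List ℕ)
goodWords n = closedWords (states n)

Unique-goodWords : ∀ n → Unique (goodWords n)
Unique-goodWords n = Unique-closedWords (states n) (Unique-states n)

length-goodWords : ∀ n → length (goodWords n) ≡ paths (suc ∘ noGroundLevel) n 0
length-goodWords n = begin
  length (goodWords n)                              ≡⟨ length-closedWords _ (states n) ⟩
  sum (map (paths _ 0 ∘ openCount) (states n))      ≡⟨ sum-states n 0 ⟩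
  paths (suc ∘ noGroundLevel) (n ℕ.+ 0) 0           ≡⟨ cong (λ m → paths (suc ∘ noGroundLevel) m 0) (+-identityʳ n) ⟩
  paths (suc ∘ noGroundLevel) n 0                   ∎
  where open ≡-Reasoning

∈-goodWords⁺ : ∀ n w → Good (const ⊤) w [] → w ↭ applyDownFrom suc n → w ∈ goodWords n
∈-goodWords⁺ n w g p = ∈-closedWords⁺ (states n)
  (∈-states⁺ n (w , []) (g , tt) (↭-trans (↭-reflexive (++-identityʳ w)) p))

∈-goodWords⁻ : ∀ n {w} → w ∈ goodWords n → Good (const ⊤) w [] × w ↭ applyDownFrom suc n
∈-goodWords⁻ n {w} i = let (g , _) , p = ∈-states⁻ n (∈-closedWords⁻ (states n) i) in
  g , ↭-trans (↭-reflexive (sym (++-identityʳ w))) p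

-- The inverse of θ

module _ {A : Set} where

  Unique-resp-↭ : {xs ys : List A} → xs ↭ ys → Unique xs → Unique ys
  Unique-resp-↭ p = Permutationₛ.Unique-resp-↭ (setoid A) (↭⇒↭ₛ p)

  Unique-⊆⇒↭++ : {xs ys : List A} → Unique xs → xs ⊆ ys → ∃ λ zs → ys ↭ xs ++ zs
  Unique-⊆⇒↭++ {[]}     {ys} _          _  = ys , ↭-refl
  Unique-⊆⇒↭++ {x ∷ xs} {ys} (x≢ ∷ xs!) xs⊆ys with u , v , refl ← ∈-∃++ (xs⊆ys (here refl)) =
    let zs , p = Unique-⊆⇒↭++ xs! λ y∈xs →
          delete (All.lookup x≢ y∈xs ∘ sym) (xs⊆ys (there y∈xs))
    in zs , ↭-trans (shift x u v) (prep x p)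
    where
    delete : ∀ {y} → y ≢ x → y ∈ u ++ x ∷ v → y ∈ u ++ v
    delete y≢x i with ∈-++⁻ u i
    ... | inj₁ i         = ∈-++⁺ˡ i
    ... | inj₂ (here e)  = ⊥-elim (y≢x e)
    ... | inj₂ (there i) = ∈-++⁺ʳ u i

  Unique-⊆⇒length≤ : {xs ys : List A} → Unique xs → xs ⊆ ys → length xs ≤ length ys
  Unique-⊆⇒length≤ {xs} {ys} xs! xs⊆ys with zs , p ← Unique-⊆⇒↭++ xs! xs⊆ys =
    subst (length xs ≤_) (sym (trans (↭-length p) (length-++ xs))) (m≤m+n _ _)

  Unique-⊆⇒↭ : {xs ys : List A} → Unique xs → xs ⊆ ys → length ys ≡ length xs → ys ↭ xs
  Unique-⊆⇒↭ {xs} xs! xs⊆ys e with Unique-⊆⇒↭++ xs! xs⊆ys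
  ... | []     , p = ↭-trans p (↭-reflexive (++-identityʳ xs))
  ... | z ∷ zs , p = contradiction
    (sym (trans (sym e) (trans (↭-length p) (length-++ xs)))) (m+1+n≢m (length xs))

module _ where
  private variable n : ℕ

  range≡ : ∀ n → range n ≡ applyUpTo suc n
  range≡ = map-upTo suc

  length-range : ∀ n → length (range n) ≡ n
  length-range n = trans (cong length (range≡ n)) (length-applyUpTo suc n)

  range-↗ : ∀ n → AllPairs _<_ (range n)
  range-↗ n rewrite range≡ n = AllPairs.applyUpTo⁺₁ suc n (λ i<j _ → s≤s i<j)

  Unique-range : ∀ n → Unique (range n)
  Unique-range n = AllPairs.map <⇒≢ (range-↗ n)

  ∈-range⁺ : ∀ {i} → i < n → suc i ∈ range n
  ∈-range⁺ i<n = ∈-map⁺ suc (∈-upTo⁺ i<n)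

  ∈-range⁻ : ∀ {x} → x ∈ range n → ∃ λ i → i < n × x ≡ suc i
  ∈-range⁻ i with j , j∈ , refl ← ∈-map⁻ suc i = j , ∈-upTo⁻ j∈ , refl

  ∈-range⇒>0 : ∀ {x} → x ∈ range n → 0 < x
  ∈-range⇒>0 i with _ , _ , refl ← ∈-range⁻ i = s≤s z≤n

  range-↭ : ∀ n → range n ↭ applyDownFrom suc n
  range-↭ n rewrite range≡ n =
    ↭-trans (↭-sym (↭-reverse (applyUpTo suc n))) (↭-reflexive (reverse-applyUpTo suc n))

  ∈-words⁺ : ∀ w → All (_∈ range n) w → w ∈ words n (length w)
  ∈-words⁺ []      _        = here refl
  ∈-words⁺ (x ∷ w) (x∈ ∷ w∈) = ∈-concatMap⁺ _ (lose x∈ (∈-map⁺ (x ∷_) (∈-words⁺ w w∈)))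

  ∈-words⁻ : ∀ k {w} → w ∈ words n k → length w ≡ k × All (_∈ range n) w
  ∈-words⁻     zero    (here refl) = refl , []
  ∈-words⁻ {n} (suc k) i with x , x∈ , j ← find (∈-concatMap⁻ (λ x → map (x ∷_) (words n k)) {xs = range n} i)
    with w , w∈ , refl ← ∈-map⁻ (x ∷_) j = let e , w∈ = ∈-words⁻ k w∈ in cong suc e , x∈ ∷ w∈

  Unique-words : ∀ n k → Unique (words n k)
  Unique-words n zero    = [] ∷ []
  Unique-words n (suc k) = Unique-concatMap (λ x → map (x ∷_) (words n k)) headOr0 (range n)
    (λ _ → Unique.map⁺ ∷-injectiveʳ (Unique-words n k))
    (λ {x} _ i → cong headOr0 (proj₂ (proj₂ (∈-map⁻ (x ∷_) i))))
    (Unique-range n)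

  ∈⇒elemᵇ : ∀ {x w} → x ∈ w → T (elemᵇ x w)
  ∈⇒elemᵇ i = Any.any⁺ _ (Any.map (≡⇒≡ᵇ _ _) i)

  elemᵇ⇒∈ : ∀ x w → T (elemᵇ x w) → x ∈ w
  elemᵇ⇒∈ x w t = Any.map (≡ᵇ⇒≡ _ _) (Any.any⁻ _ w t)

  distinctᵇ⁺ : ∀ w → Unique w → T (distinctᵇ w)
  distinctᵇ⁺ []      _ = tt
  distinctᵇ⁺ (x ∷ w) (x≢ ∷ w!) with elemᵇ x w in eq
  ... | false = distinctᵇ⁺ w w!
  ... | true  = All.lookup x≢ (elemᵇ⇒∈ x w (from Bool.T-≡ eq)) refl

  distinctᵇ⁻ : ∀ w → T (distinctᵇ w) → Unique w
  distinctᵇ⁻ []      _ = []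
  distinctᵇ⁻ (x ∷ w) t with elemᵇ x w in eq
  ... | false = All.tabulate (λ { i refl → subst T eq (∈⇒elemᵇ i) }) ∷ distinctᵇ⁻ w t

  Unique-S : ∀ n → Unique (S n)
  Unique-S n = Unique.filter⁺ _ (Unique-words n n)

  ∈-S⁻ : ∀ n {w} → w ∈ S n → w ↭ range n
  ∈-S⁻ n {w} i with w∈ , d ← ∈-filter⁻ (λ w → distinctᵇ w Bool.≟ true) {xs = words n n} i
    with e , all∈ ← ∈-words⁻ n w∈ =
    ↭-sym (Unique-⊆⇒↭ (distinctᵇ⁻ w (from Bool.T-≡ d)) (All.lookup all∈) (trans (length-range n) (sym e)))

  ∈-S⁺ : ∀ n {w} → w ↭ range n → w ∈ S n
  ∈-S⁺ n {w} p = ∈-filter⁺ (λ w → distinctᵇ w Bool.≟ true)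
    (subst (λ k → w ∈ words n k) (trans (↭-length p) (length-range n))
      (∈-words⁺ w (All.tabulate (∈-resp-↭ p))))
    (to Bool.T-≡ (distinctᵇ⁺ w (Unique-resp-↭ (↭-sym p) (Unique-range n))))

sorted-≡ : ∀ {xs ys} → AllPairs _<_ xs → AllPairs _<_ ys → xs ⊆ ys → ys ⊆ xs → xs ≡ ys
sorted-≡ {[]}     {[]}     _ _ _ _ = refl
sorted-≡ {[]}     {y ∷ ys} _ _ _ q with () ← q (here refl)
sorted-≡ {x ∷ xs} {[]}     _ _ p _ with () ← p (here refl)
sorted-≡ {x ∷ xs} {y ∷ ys} (x< ∷ xs↗) (y< ∷ ys↗) p q = helper (heads (p (here refl)) (q (here refl)))
  where
  heads : x ∈ y ∷ ys → y ∈ x ∷ xs → x ≡ y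
  heads (here e)  _         = e
  heads (there _) (here e)  = sym e
  heads (there i) (there j) = ⊥-elim (<-asym (All.lookup x< j) (All.lookup y< i))
  tail : ∀ {z zs ws} → All (z <_) zs → zs ⊆ z ∷ ws → zs ⊆ ws
  tail z< r i with r i
  ... | here refl = ⊥-elim (<-irrefl refl (All.lookup z< i))
  ... | there j   = j
  helper : x ≡ y → x ∷ xs ≡ y ∷ ys
  helper refl = cong (x ∷_) (sorted-≡ xs↗ ys↗ (tail x< (p ∘ there)) (tail y< (q ∘ there)))

-- If w is the part of θ σ to the right of a letter whose cycle has maximum m, then next m w is
-- the σ-image of that letter: the next letter of θ σ, unless this letter starts a new cycle.
next : ℕ → List ℕ → ℕ
next m []      = m
next m (y ∷ w) = y ⊓ m

images : ℕ → List ℕ → List ℕ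
images m []      = []
images m (y ∷ w) = next (m ⊔ y) w ∷ images (m ⊔ y) w

image : ℕ → List ℕ → ℕ → ℕ
image m []      x = 0
image m (y ∷ w) x with x ≟ y
... | yes _ = next (m ⊔ y) w
... | no  _ = image (m ⊔ y) w x

inverse-θ : List ℕ → List ℕ
inverse-θ π = map (image 0 π) (range (length π))

records : ℕ → List ℕ → List ℕ
records m []      = []
records m (y ∷ w) with y <? m
... | yes _ = records m w
... | no  _ = y ∷ records y w

-- Along the word exactly one value is still owed as an image, namely the running maximum `m`. It is
-- paid when a larger letter closes its cycle, and that letter is owed from then on.
images-↭ : ∀ m w → next m w ∷ images m w ↭ m ∷ w
images-↭ m []      = ↭-refl
images-↭ m (y ∷ w) with ≤-total y m
... | inj₁ y≤m rewrite m≤n⇒m⊓n≡m y≤m | m≥n⇒m⊔n≡m y≤m =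
  ↭-trans (prep y (images-↭ m w)) (swap y m ↭-refl)
... | inj₂ m≤y rewrite m≥n⇒m⊓n≡n m≤y | m≤n⇒m⊔n≡n m≤y = prep m (images-↭ y w)

images-0-↭ : ∀ π → images 0 π ↭ π
images-0-↭ []      = ↭-refl
images-0-↭ (y ∷ w) = images-↭ y w

image-here : ∀ m y w → image m (y ∷ w) y ≡ next (m ⊔ y) w
image-here m y w with y ≟ y
... | yes _  = refl
... | no y≢y = ⊥-elim (y≢y refl)

image-there : ∀ m {x y} w → x ≢ y → image m (y ∷ w) x ≡ image (m ⊔ y) w x
image-there m {x} {y} w x≢y with x ≟ y
... | yes x≡y = ⊥-elim (x≢y x≡y)
... | no _    = refl

map-image : ∀ m w → Unique w → map (image m w) w ≡ images m w
map-image m []      _        = refl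
map-image m (y ∷ w) (y≢ ∷ w!) = cong₂ _∷_ (image-here m y w) (trans
  (map-cong-local (All.map (λ y≢x → image-there m w (y≢x ∘ sym)) y≢))
  (map-image (m ⊔ y) w w!))

app-applyUpTo : ∀ (h : ℕ → ℕ) n {i} → i < n → app (applyUpTo h n) (suc i) ≡ h i
app-applyUpTo h (suc n) {zero}  _         = refl
app-applyUpTo h (suc n) {suc i} (s≤s i<n) = app-applyUpTo (h ∘ suc) n i<n

app-map-range : ∀ (h : ℕ → ℕ) n {x} → x ∈ range n → app (map h (range n)) x ≡ h x
app-map-range h n x∈ with i , i<n , refl ← ∈-range⁻ {n} x∈
  rewrite range≡ n | map-applyUpTo suc h n = app-applyUpTo (h ∘ suc) n i<n

module _ n {π} (p : π ↭ range n) where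

  private
    length-π : length π ≡ n
    length-π = trans (↭-length p) (length-range n)

  inverse-θ≡ : inverse-θ π ≡ map (image 0 π) (range n)
  inverse-θ≡ = cong (map (image 0 π) ∘ range) length-π

  app-inverse-θ : ∀ {x} → x ∈ range n → app (inverse-θ π) x ≡ image 0 π x
  app-inverse-θ x∈ rewrite inverse-θ≡ = app-map-range (image 0 π) n x∈

  map-app-inverse-θ : map (app (inverse-θ π)) π ≡ images 0 π
  map-app-inverse-θ = trans
    (map-cong-local (All.tabulate (λ i → app-inverse-θ (∈-resp-↭ p i))))
    (map-image 0 π (Unique-resp-↭ (↭-sym p) (Unique-range n)))

  inverse-θ-↭ : inverse-θ π ↭ range n
  inverse-θ-↭ rewrite inverse-θ≡ = ↭-trans (map⁺ (image 0 π) (↭-sym p))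
    (↭-trans (↭-reflexive (map-image 0 π (Unique-resp-↭ (↭-sym p) (Unique-range n))))
    (↭-trans (images-0-↭ π) p))


records-⊆ : ∀ m w → records m w ⊆ w
records-⊆ m (y ∷ w) i with y <? m
... | yes _ = there (records-⊆ m w i)
records-⊆ m (y ∷ w) (here e)  | no _ = here e
records-⊆ m (y ∷ w) (there i) | no _ = there (records-⊆ y w i)

records-> : ∀ m w → m ∉ w → Unique w → All (m <_) (records m w)
records-> m []      _  _         = []
records-> m (y ∷ w) m∉ (y≢ ∷ w!) with y <? m
... | yes _  = records-> m w (m∉ ∘ there) w!
... | no y≮m = let m<y = ≤∧≢⇒< (≮⇒≥ y≮m) (m∉ ∘ here) in
  m<y ∷ All.map (<-trans m<y) (records-> y w (Unique.Unique[x∷xs]⇒x∉xs (y≢ ∷ w!)) w!)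

records-↗ : ∀ m w → Unique w → AllPairs _<_ (records m w)
records-↗ m []      _           = []
records-↗ m (y ∷ w) y∷w!@(_ ∷ w!) with y <? m
... | yes _ = records-↗ m w w!
... | no _  = records-> y w (Unique.Unique[x∷xs]⇒x∉xs y∷w!) w! ∷ records-↗ y w w!

-- Recovering a word from the cycles of σ.

module _ (σ : List ℕ) where

  cycleFrom-stop : ∀ {m x} fuel → x ≡ m → cycleFrom σ m fuel x ≡ []
  cycleFrom-stop             zero       _    = refl
  cycleFrom-stop {m} {x} (suc fuel) refl with x ≡ᵇ x in eq
  ... | true  = refl
  ... | false = ⊥-elim (subst T eq (≡⇒≡ᵇ x x refl))

  cycleFrom-step : ∀ {m x y} fuel → x ≡ y → y ≢ m →
    cycleFrom σ m (suc fuel) x ≡ y ∷ cycleFrom σ m fuel (app σ y)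
  cycleFrom-step {m} {x} fuel refl x≢m with x ≡ᵇ m in eq
  ... | true  = ⊥-elim (x≢m (≡ᵇ⇒≡ x m (from Bool.T-≡ eq)))
  ... | false = refl

  -- The situation after reading the letter `x`: the current cycle has maximum `m`, the letters `w`
  -- remain, and σ acts on `x` and on `w` as `next` and `images` prescribe.
  Follows : ℕ → ℕ → List ℕ → Set
  Follows m x w = app σ x ≡ next m w × map (app σ) w ≡ images m w

  follows-there : ∀ {m x y w} → Follows m x (y ∷ w) → Follows (m ⊔ y) y w
  follows-there (_ , e) = ∷-injectiveˡ e , ∷-injectiveʳ e

  follows-< : ∀ {m x y w} → y < m → Follows m x (y ∷ w) → app σ x ≡ y × Follows m y w
  follows-< {m} {y = y} {w} y<m φ@(e , _) = trans e (m≤n⇒m⊓n≡m (<⇒≤ y<m)) ,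
    subst (λ k → Follows k y w) (m≥n⇒m⊔n≡m (<⇒≤ y<m)) (follows-there φ)

  follows-≥ : ∀ {m x y w} → m ≤ y → Follows m x (y ∷ w) → app σ x ≡ m × Follows y y w
  follows-≥ {m} {y = y} {w} m≤y φ@(e , _) = trans e (m≥n⇒m⊓n≡n m≤y) ,
    subst (λ k → Follows k y w) (m≤n⇒m⊔n≡n m≤y) (follows-there φ)

  -- What remains of the word is the rest of the current cycle, followed by the full cycles of the
  -- later records. Two bounds are needed, because the current cycle runs on `fuel` while every
  -- later one restarts with `length σ`.
  concat-cycles : ∀ fuel m x w → length w < fuel → length w < length σ → Follows m x w →
    cycleFrom σ m fuel (app σ x) ++ concat (map (cycleOf σ) (records m w)) ≡ w
  concat-cycles fuel m x [] _ _ (e , _) = trans (++-identityʳ _) (cycleFrom-stop fuel e)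
  concat-cycles (suc fuel) m x (y ∷ w) (s≤s <fuel) <σ φ with y <? m
  ... | yes y<m with e , ψ ← follows-< y<m φ =
    trans (cong (_++ concat (map (cycleOf σ) (records m w))) (cycleFrom-step fuel e (<⇒≢ y<m)))
          (cong (y ∷_) (concat-cycles fuel m y w <fuel (<-trans (n<1+n _) <σ) ψ))
  ... | no y≮m with e , ψ ← follows-≥ (≮⇒≥ y≮m) φ =
    trans (cong (_++ (cycleOf σ y ++ concat (map (cycleOf σ) (records y w)))) (cycleFrom-stop (suc fuel) e))
          (cong (y ∷_) (concat-cycles (length σ) y y w (<-trans (n<1+n _) <σ) (<-trans (n<1+n _) <σ) ψ))

  cycleFrom-≤ : ∀ fuel m x w → Follows m x w → All (_≤ m) (cycleFrom σ m fuel (app σ x))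
  cycleFrom-≤ zero m x w φ = []
  cycleFrom-≤ (suc fuel) m x [] (e , _) rewrite cycleFrom-stop (suc fuel) e = []
  cycleFrom-≤ (suc fuel) m x (y ∷ w) φ with y <? m
  ... | yes y<m with e , ψ ← follows-< y<m φ rewrite cycleFrom-step fuel e (<⇒≢ y<m) =
    <⇒≤ y<m ∷ cycleFrom-≤ fuel m y w ψ
  ... | no y≮m with e , _ ← follows-≥ (≮⇒≥ y≮m) φ rewrite cycleFrom-stop (suc fuel) e = []

  -- The walk reads letters of `w` until the cycle closes at `m`. It cannot stop at `z` before that,
  -- since `z` does not occur in `w`.
  cycleFrom-∋ : ∀ fuel z m x w → length w < fuel → z ∉ w → m ≢ z → Follows m x w →
    m ∈ cycleFrom σ z fuel (app σ x)
  cycleFrom-∋ (suc fuel) z m x [] _ _ m≢z (e , _) rewrite cycleFrom-step fuel e m≢z = here refl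
  cycleFrom-∋ (suc fuel) z m x (y ∷ w) (s≤s <fuel) z∉ m≢z φ with y <? m
  ... | yes y<m with e , ψ ← follows-< y<m φ rewrite cycleFrom-step fuel e (z∉ ∘ here ∘ sym) =
    there (cycleFrom-∋ fuel z m y w <fuel (z∉ ∘ there) m≢z ψ)
  ... | no y≮m with e , _ ← follows-≥ (≮⇒≥ y≮m) φ rewrite cycleFrom-step fuel e m≢z = here refl

  records-cycleMax : ∀ m w → map (app σ) w ≡ images m w → ∀ {r} → r ∈ records m w → All (_≤ r) (cycleOf σ r)
  records-cycleMax m (y ∷ w) e i with y <? m
  ... | yes y<m = records-cycleMax m w
    (subst (λ k → map (app σ) w ≡ images k w) (m≥n⇒m⊔n≡m (<⇒≤ y<m)) (∷-injectiveʳ e)) i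
  records-cycleMax m (y ∷ w) e i | no y≮m
    with ψ@(_ , e′) ← subst (λ k → Follows k y w) (m≤n⇒m⊔n≡n (≮⇒≥ y≮m)) (∷-injectiveˡ e , ∷-injectiveʳ e) with i
  ... | here refl = ≤-refl ∷ cycleFrom-≤ (length σ) y y w ψ
  ... | there i   = records-cycleMax y w e′ i

  cycleMax-records : ∀ m w → Unique w → length w ≤ length σ → map (app σ) w ≡ images m w →
    ∀ {x} → x ∈ w → All (_≤ x) (cycleOf σ x) → x ∈ records m w
  cycleMax-records m (y ∷ w) y∷w!@(_ ∷ w!) ≤σ e i max with y <? m
  cycleMax-records m (y ∷ w) y∷w!@(_ ∷ w!) ≤σ e i max | yes y<m
    with ψ@(_ , e′) ← subst (λ k → Follows k y w) (m≥n⇒m⊔n≡m (<⇒≤ y<m)) (∷-injectiveˡ e , ∷-injectiveʳ e) with i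
  -- A letter below the running maximum `m` has `m` on its cycle, so it is not a cycle maximum.
  ... | here refl = ⊥-elim (<⇒≱ y<m (All.lookup (All.tail max)
    (cycleFrom-∋ (length σ) y m y w ≤σ (Unique.Unique[x∷xs]⇒x∉xs y∷w!) (<⇒≢ y<m ∘ sym) ψ)))
  ... | there i   = cycleMax-records m w w! (<⇒≤ ≤σ) e′ i max
  cycleMax-records m (y ∷ w) y∷w!@(_ ∷ w!) ≤σ e i max | no y≮m with i
  ... | here refl = here refl
  ... | there i   = there (cycleMax-records y w w! (<⇒≤ ≤σ)
    (subst (λ k → map (app σ) w ≡ images k w) (m≤n⇒m⊔n≡n (≮⇒≥ y≮m)) (∷-injectiveʳ e)) i max)

  isCycleMax⁺ : ∀ m → All (_≤ m) (cycleOf σ m) → isCycleMax σ m ≡ true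
  isCycleMax⁺ m a = to Bool.T-≡ (All.all⁻ _ (All.map ≤⇒≤ᵇ a))

  isCycleMax⁻ : ∀ m → isCycleMax σ m ≡ true → All (_≤ m) (cycleOf σ m)
  isCycleMax⁻ m e = All.map (≤ᵇ⇒≤ _ _) (All.all⁺ _ (cycleOf σ m) (from Bool.T-≡ e))

  θ-unique : ∀ {π} → π ↭ range (length σ) → map (app σ) π ≡ images 0 π → θ σ ≡ π
  θ-unique {π} p e = trans (cong (concat ∘ map (cycleOf σ)) cycleMaxima) (concat-records π ≤σ e)
    where
    n : ℕ
    n = length σ
    π! : Unique π
    π! = Unique-resp-↭ (↭-sym p) (Unique-range n)
    ≤σ : length π ≤ n
    ≤σ = ≤-reflexive (trans (↭-length p) (length-range n))
    isMax? = λ m → isCycleMax σ m Bool.≟ true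
    cycleMaxima : filter isMax? (range n) ≡ records 0 π
    -- Both lists are strictly increasing, so having the same elements is enough.
    cycleMaxima = sorted-≡ (AllPairs.filter⁺ isMax? (range-↗ n)) (records-↗ 0 π π!)
      (λ {x} i → let x∈ , max = ∈-filter⁻ isMax? {xs = range n} i in
        cycleMax-records 0 π π! ≤σ e (∈-resp-↭ (↭-sym p) x∈) (isCycleMax⁻ x max))
      (λ {x} i → ∈-filter⁺ isMax? (∈-resp-↭ p (records-⊆ 0 π i))
        (isCycleMax⁺ x (records-cycleMax 0 π e i)))
    concat-records : ∀ π → length π ≤ n → map (app σ) π ≡ images 0 π →
      concat (map (cycleOf σ) (records 0 π)) ≡ π
    concat-records []      _  _ = refl
    concat-records (y ∷ w) ≤σ e =
      cong (y ∷_) (concat-cycles n y y w ≤σ ≤σ (∷-injectiveˡ e , ∷-injectiveʳ e))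

θ-inverse-θ : ∀ n {π} → π ↭ range n → θ (inverse-θ π) ≡ π
θ-inverse-θ n {π} p = θ-unique (inverse-θ π)
  (subst (λ k → π ↭ range k) (sym (trans (↭-length (inverse-θ-↭ n p)) (length-range n))) p)
  (map-app-inverse-θ n p)

-- Having `θ` as a left inverse, `inverse-θ` is injective on the finite list `S n` and maps it into
-- itself, hence it is also surjective. This makes it a two-sided inverse.
inverse-θ-permutes-S : ∀ n → S n ↭ map inverse-θ (S n)
inverse-θ-permutes-S n = Unique-⊆⇒↭ image-! image-⊆ (sym (length-map inverse-θ (S n)))
  where
  image-! : Unique (map inverse-θ (S n))
  image-! = Unique.map⁻ {f = θ} (subst Unique
    (sym (trans (sym (map-∘ (S n))) (map-id-local (All.tabulate (θ-inverse-θ n ∘ ∈-S⁻ n)))))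
    (Unique-S n))
  image-⊆ : map inverse-θ (S n) ⊆ S n
  image-⊆ i with π , π∈ , refl ← ∈-map⁻ inverse-θ i = ∈-S⁺ n (inverse-θ-↭ n (∈-S⁻ n π∈))

inverse-θ-θ : ∀ n {σ} → σ ∈ S n → inverse-θ (θ σ) ≡ σ
inverse-θ-θ n σ∈ with π , π∈ , refl ← ∈-map⁻ inverse-θ (∈-resp-↭ (inverse-θ-permutes-S n) σ∈) =
  cong inverse-θ (θ-inverse-θ n (∈-S⁻ n π∈))

-- Occurrences of the pattern

app-∈ : ∀ w i → i < length w → app w (suc i) ∈ w
app-∈ (x ∷ w) zero    _        = here refl
app-∈ (x ∷ w) (suc i) (s<s i<) = there (app-∈ w i i<)

∈-app : ∀ {x} w → x ∈ w → ∃ λ i → i < length w × app w (suc i) ≡ x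
∈-app (x ∷ w) (here refl) = 0 , z<s , refl
∈-app (y ∷ w) (there i)   = let j , j< , e = ∈-app w i in suc j , s<s j< , e

next-≤ : ∀ m w → next m w ≤ m
next-≤ m []      = ≤-refl
next-≤ m (y ∷ w) = m⊓n≤n y m

-- A smaller letter later on rules out the third clause of `Good`. A smaller successor bounds the
-- image from above, and a letter exceeding the running maximum `m` is itself the maximum of its
-- cycle so far.
Good⇒image≤ : ∀ m w → Unique w → Good (m <_) w [] → ∀ i j → i < j → j < length w →
  app w (suc j) < app w (suc i) → image m w (app w (suc i)) ≤ app w (suc i)
Good⇒image≤ m (x ∷ w) _ (c , _) zero (suc j) _ (s<s j<) lt rewrite image-here m x w with w | c
... | y ∷ w | inj₁ y<x        = <⇒≤ (m<n⇒m⊓o<n _ y<x)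
... | w     | inj₂ (inj₁ m<x) = subst (next (m ⊔ x) w ≤_) (m≤n⇒m⊔n≡n (<⇒≤ m<x)) (next-≤ (m ⊔ x) w)
... | w     | inj₂ (inj₂ x<)  = ⊥-elim (<-asym lt (All.lookup x< (∈-++⁺ˡ (app-∈ w j j<))))
Good⇒image≤ m (x ∷ w) (x≢ ∷ w!) (_ , g) (suc i) (suc j) (s<s i<j) (s<s j<) lt
  rewrite image-there m {app w (suc i)} {x} w (All.lookup x≢ (app-∈ w i (<-trans i<j j<)) ∘ sym) =
  Good⇒image≤ (m ⊔ x) w w! (Good-map w (All.universal (λ _ (m<y , x<y) → ⊔-pres-<m m<y x<y) w) g) i j i<j j< lt

-- If a letter has a larger successor and lies below the running maximum `m`, then its image, the
-- smaller of these two, exceeds it; the hypothesis then leaves no smaller letter after it. That `m`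
-- does not occur in the word makes the comparison with `m` strict.
¬image>⇒Good : ∀ m w → Unique w → m ∉ w →
  (∀ i j → i < j → j < length w → app w (suc j) < app w (suc i) →
    image m w (app w (suc i)) ≤ app w (suc i)) →
  Good (m <_) w []
¬image>⇒Good m []      _           _  _ = tt
¬image>⇒Good m (x ∷ w) (x≢ ∷ w!) m∉ h = head , Good-map w (All.universal split w)
  (¬image>⇒Good (m ⊔ x) w w! m⊔x∉w tail)
  where
  split : ∀ y → m ⊔ x < y → m < y × x < y
  split y p = m⊔n<o⇒m<o m x p , m⊔n<o⇒n<o m x p
  m⊔x∉w : m ⊔ x ∉ w
  m⊔x∉w i with ⊔-sel m x
  ... | inj₁ e = m∉ (there (subst (_∈ w) e i))
  ... | inj₂ e = All.lookup x≢ (subst (_∈ w) e i) refl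
  tail : ∀ i j → i < j → j < length w → app w (suc j) < app w (suc i) →
    image (m ⊔ x) w (app w (suc i)) ≤ app w (suc i)
  tail i j i<j j< lt =
    subst (_≤ app w (suc i)) (image-there m w (All.lookup x≢ (app-∈ w i (<-trans i<j j<)) ∘ sym))
      (h (suc i) (suc j) (s<s i<j) (s<s j<) lt)
  smallest : x < next (m ⊔ x) w → All (x <_) (w ++ [])
  smallest x<next rewrite ++-identityʳ w = All.tabulate λ {y} y∈ → larger y∈ (<-cmp x y)
    where
    larger : ∀ {y} → y ∈ w → _ → x < y
    larger y∈ (tri< x<y _ _) = x<y
    larger y∈ (tri≈ _ x≡y _) = ⊥-elim (All.lookup x≢ y∈ x≡y)
    larger y∈ (tri> _ _ y<x) with j , j< , refl ← ∈-app w y∈ =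
      ⊥-elim (<⇒≱ x<next (subst (_≤ x) (image-here m x w) (h 0 (suc j) z<s (s<s j<) y<x)))
  nextAbove : ∀ w → All (x ≢_) w → ¬ NextBelow x w → ¬ m < x → x < next (m ⊔ x) w ⊎ w ≡ []
  nextAbove []      _         _    _    = inj₂ refl
  nextAbove (y ∷ w) (x≢y ∷ _) y≮x m≮x = inj₁ (⊓-pres-m< (≤∧≢⇒< (≮⇒≥ y≮x) x≢y)
    (m<n⇒m<n⊔o x (≤∧≢⇒< (≮⇒≥ m≮x) (m∉ ∘ here ∘ sym))))
  nextBelow? : ∀ w → NextBelow x w ⊎ ¬ NextBelow x w
  nextBelow? []      = inj₂ λ ()
  nextBelow? (y ∷ w) with y <? x
  ... | yes p = inj₁ p
  ... | no ¬p = inj₂ ¬p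
  head : NextBelow x w ⊎ m < x ⊎ All (x <_) (w ++ [])
  head with nextBelow? w | m <? x
  ... | inj₁ p  | _       = inj₁ p
  ... | inj₂ ¬p | yes m<x = inj₂ (inj₁ m<x)
  ... | inj₂ ¬p | no m≮x with nextAbove w x≢ ¬p m≮x
  ...   | inj₁ x<next = inj₂ (inj₂ (smallest x<next))
  ...   | inj₂ refl   = inj₂ (inj₂ [])

listEqᵇ⁻ : ∀ v w → T (listEqᵇ v w) → v ≡ w
listEqᵇ⁻ []      []      _ = refl
listEqᵇ⁻ (x ∷ v) (y ∷ w) t = let e , t = to Bool.T-∧ t in cong₂ _∷_ (≡ᵇ⇒≡ x y e) (listEqᵇ⁻ v w t)

listEqᵇ-refl : ∀ w → T (listEqᵇ w w)
listEqᵇ-refl []      = tt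
listEqᵇ-refl (x ∷ w) = from Bool.T-∧ (≡⇒≡ᵇ x x refl , listEqᵇ-refl w)

¬T⇒≡false : ∀ {b} → ¬ T b → b ≡ false
¬T⇒≡false {false} _  = refl
¬T⇒≡false {true}  ¬t = ⊥-elim (¬t tt)

any-find : ∀ {A : Set} (p : A → Bool) xs → T (any p xs) → ∃ λ x → x ∈ xs × T (p x)
any-find p xs t = find (Any.any⁻ p xs t)

any-lose : ∀ {A : Set} (p : A → Bool) {xs x} → x ∈ xs → T (p x) → T (any p xs)
any-lose p x∈ t = Any.any⁺ p (lose x∈ t)

-- This and the next tests, up to `occursAt`, name the nested parts of `contains-21-2→3`, to which
-- they unfold, so that they can be passed as explicit predicates.
inversionAt : List ℕ → ℕ → ℕ → ℕ → ℕ → Bool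
inversionAt π x₁ x₂ t₁ t₂ = (t₁ <ᵇ t₂) ∧ (app π t₁ ≡ᵇ x₂) ∧ (app π t₂ ≡ᵇ x₁)

inversion : ℕ → List ℕ → ℕ → ℕ → Bool
inversion n π x₁ x₂ = any (λ t₁ → any (inversionAt π x₁ x₂ t₁) (range n)) (range n)

arrowIn : List ℕ → ℕ → ℕ → List ℕ → Bool
arrowIn π x₂ x₃ σ = listEqᵇ (θ σ) π ∧ (app σ x₂ ≡ᵇ x₃)

arrow : ℕ → List ℕ → ℕ → ℕ → Bool
arrow n π x₂ x₃ = any (arrowIn π x₂ x₃) (S n)

occursAt : ℕ → List ℕ → ℕ → ℕ → ℕ → Bool
occursAt n π x₁ x₂ x₃ = (x₁ <ᵇ x₂) ∧ (x₂ <ᵇ x₃) ∧ inversion n π x₁ x₂ ∧ arrow n π x₂ x₃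

-- The value x₃ is determined as the image of x₂, so only an inequality remains of the arrow. The
-- indices count from 0, unlike the positions in `app`.
Occurrence : List ℕ → Set
Occurrence π = ∃₂ λ i j → i < j × j < length π ×
  app π (suc j) < app π (suc i) × app π (suc i) < image 0 π (app π (suc i))

module _ n {π} (π∈ : π ∈ S n) where

  private
    p : π ↭ range n
    p = ∈-S⁻ n π∈

    length-π : length π ≡ n
    length-π = trans (↭-length p) (length-range n)

    >0 : ∀ {x} → x ∈ π → 0 < x
    >0 x∈ = ∈-range⇒>0 (∈-resp-↭ p x∈)

    π! : Unique π
    π! = Unique-resp-↭ (↭-sym p) (Unique-range n)

  inversion⁻ : ∀ x₁ x₂ → T (inversion n π x₁ x₂) →
    ∃₂ λ i j → i < j × j < n × app π (suc i) ≡ x₂ × app π (suc j) ≡ x₁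
  inversion⁻ x₁ x₂ t =
    let t₁ , t₁∈ , t = any-find (λ t₁ → any (inversionAt π x₁ x₂ t₁) (range n)) (range n) t
        t₂ , t₂∈ , t = any-find (inversionAt π x₁ x₂ t₁) (range n) t
        i , _ , t₁≡ = ∈-range⁻ {n} t₁∈
        j , j<n , t₂≡ = ∈-range⁻ {n} t₂∈
        t₁<t₂ , t = to (Bool.T-∧ {t₁ <ᵇ t₂}) t
        e₂ , e₁ = to (Bool.T-∧ {app π t₁ ≡ᵇ x₂}) t
    in i , j , ≤-pred (subst₂ _<_ t₁≡ t₂≡ (<ᵇ⇒< t₁ t₂ t₁<t₂)) , j<n ,
       trans (cong (app π) (sym t₁≡)) (≡ᵇ⇒≡ _ x₂ e₂) , trans (cong (app π) (sym t₂≡)) (≡ᵇ⇒≡ _ x₁ e₁)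

  inversion⁺ : ∀ i j → i < j → j < n → T (inversion n π (app π (suc j)) (app π (suc i)))
  inversion⁺ i j i<j j<n =
    any-lose (λ t₁ → any (inversionAt π x₁ x₂ t₁) (range n)) (∈-range⁺ (<-trans i<j j<n))
      (any-lose (inversionAt π x₁ x₂ (suc i)) (∈-range⁺ j<n)
        (from (Bool.T-∧ {suc i <ᵇ suc j}) (<⇒<ᵇ (s<s i<j) ,
          from (Bool.T-∧ {x₂ ≡ᵇ x₂}) (≡⇒≡ᵇ x₂ x₂ refl , ≡⇒≡ᵇ x₁ x₁ refl))))
    where
    x₁ x₂ : ℕ
    x₁ = app π (suc j)
    x₂ = app π (suc i)

  arrow⁻ : ∀ x₂ x₃ → x₂ ∈ range n → T (arrow n π x₂ x₃) → image 0 π x₂ ≡ x₃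
  arrow⁻ x₂ x₃ x₂∈ t =
    let σ , σ∈ , t = any-find (arrowIn π x₂ x₃) (S n) t
        e₁ , e₂ = to (Bool.T-∧ {listEqᵇ (θ σ) π}) t
        -- The search may return any σ with `θ σ` equal to π; the left inverse property identifies
        -- it.
        inverse : inverse-θ π ≡ σ
        inverse = trans (cong inverse-θ (sym (listEqᵇ⁻ (θ σ) π e₁))) (inverse-θ-θ n σ∈)
    in trans (sym (app-inverse-θ n p x₂∈)) (trans (cong (λ σ → app σ x₂) inverse) (≡ᵇ⇒≡ _ x₃ e₂))

  arrow⁺ : ∀ x₂ → x₂ ∈ range n → T (arrow n π x₂ (image 0 π x₂))
  arrow⁺ x₂ x₂∈ = any-lose (arrowIn π x₂ (image 0 π x₂)) (∈-S⁺ n (inverse-θ-↭ n p))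
    (from (Bool.T-∧ {listEqᵇ (θ (inverse-θ π)) π})
      ( subst (λ w → T (listEqᵇ w π)) (sym (θ-inverse-θ n p)) (listEqᵇ-refl π)
      , ≡⇒≡ᵇ _ _ (app-inverse-θ n p x₂∈)))

  contains⇒Occurrence : T (contains-21-2→3 n π) → Occurrence π
  contains⇒Occurrence t =
    let x₁ , _ , t = any-find (λ x₁ → any (λ x₂ → any (occursAt n π x₁ x₂) (range n)) (range n)) (range n) t
        x₂ , x₂∈ , t = any-find (λ x₂ → any (occursAt n π x₁ x₂) (range n)) (range n) t
        x₃ , _ , t = any-find (occursAt n π x₁ x₂) (range n) t
        x₁<x₂ , t = to (Bool.T-∧ {x₁ <ᵇ x₂}) t
        x₂<x₃ , t = to (Bool.T-∧ {x₂ <ᵇ x₃}) t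
        inv , arr = to (Bool.T-∧ {inversion n π x₁ x₂} {arrow n π x₂ x₃}) t
        i , j , i<j , j<n , e₂ , e₁ = inversion⁻ x₁ x₂ inv
    in i , j , i<j , subst (j <_) (sym length-π) j<n ,
       subst₂ _<_ (sym e₁) (sym e₂) (<ᵇ⇒< x₁ x₂ x₁<x₂) ,
       subst (λ x → x < image 0 π x) (sym e₂)
         (subst (x₂ <_) (sym (arrow⁻ x₂ x₃ x₂∈ arr)) (<ᵇ⇒< x₂ x₃ x₂<x₃))

  Occurrence⇒contains : Occurrence π → T (contains-21-2→3 n π)
  Occurrence⇒contains (i , j , i<j , j< , x₁<x₂ , x₂<x₃) =
    any-lose (λ x₁ → any (λ x₂ → any (occursAt n π x₁ x₂) (range n)) (range n)) x₁∈
      (any-lose (λ x₂ → any (occursAt n π x₁ x₂) (range n)) x₂∈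
        (any-lose (occursAt n π x₁ x₂) x₃∈
          (from (Bool.T-∧ {x₁ <ᵇ x₂}) (<⇒<ᵇ x₁<x₂ , from (Bool.T-∧ {x₂ <ᵇ x₃}) (<⇒<ᵇ x₂<x₃ ,
            from (Bool.T-∧ {inversion n π x₁ x₂} {arrow n π x₂ x₃}) (inversion⁺ i j i<j j<n , arrow⁺ x₂ x₂∈))))))
    where
    x₁ x₂ x₃ : ℕ
    x₁ = app π (suc j)
    x₂ = app π (suc i)
    x₃ = image 0 π x₂
    j<n : j < n
    j<n = subst (j <_) length-π j<
    x₁∈ : x₁ ∈ range n
    x₁∈ = ∈-resp-↭ p (app-∈ π j j<)
    x₂∈ : x₂ ∈ range n
    x₂∈ = ∈-resp-↭ p (app-∈ π i (<-trans i<j j<))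
    app-∈-range : ∀ {σ x} → σ ↭ range n → x ∈ range n → app σ x ∈ range n
    app-∈-range {σ} q x∈ with k , k<n , refl ← ∈-range⁻ {n} x∈ =
      ∈-resp-↭ q (app-∈ σ k (subst (k <_) (sym (trans (↭-length q) (length-range n))) k<n))
    x₃∈ : x₃ ∈ range n
    x₃∈ = subst (_∈ range n) (app-inverse-θ n p x₂∈) (app-∈-range (inverse-θ-↭ n p) x₂∈)

  Good⇒avoids : Good (const ⊤) π [] → contains-21-2→3 n π ≡ false
  Good⇒avoids g = ¬T⇒≡false λ t →
    let i , j , i<j , j< , lt , gt = contains⇒Occurrence t
    -- All letters are positive, so `const ⊤` may be replaced by exceeding the initial running
    -- maximum 0.
    in <⇒≱ gt (Good⇒image≤ 0 π π! (Good-map π (All.tabulate λ i _ → >0 i) g) i j i<j j< lt)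

  avoids⇒Good : contains-21-2→3 n π ≡ false → Good (const ⊤) π []
  avoids⇒Good eq = Good-map π (All.universal _ π)
    (¬image>⇒Good 0 π π! (λ 0∈ → <-irrefl refl (>0 0∈)) λ i j i<j j< lt → ≮⇒≥ λ gt →
      subst T eq (Occurrence⇒contains (i , j , i<j , j< , lt , gt)))

-- The number of avoiding permutations.

a≡paths : ∀ n → a n ≡ paths (suc ∘ noGroundLevel) n 0
a≡paths n = trans (≤-antisym
  -- The avoiding permutations and the good words form two duplicate-free lists, each contained in
  -- the other.
  (Unique-⊆⇒length≤ (Unique.filter⁺ avoids? (Unique-S n)) λ i →
    let π∈ , av = ∈-filter⁻ avoids? {xs = S n} i in
    ∈-goodWords⁺ n _ (avoids⇒Good n π∈ av) (↭-trans (∈-S⁻ n π∈) (range-↭ n)))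
  (Unique-⊆⇒length≤ (Unique-goodWords n) λ i →
    let g , p = ∈-goodWords⁻ n i
        π∈    = ∈-S⁺ n (↭-trans p (↭-sym (range-↭ n)))
    in ∈-filter⁺ avoids? π∈ (Good⇒avoids n π∈ g)))
  (length-goodWords n)
  where
  avoids? = λ π → contains-21-2→3 n π Bool.≟ false

open import Data.Integer using (ℤ; +_; _*_)

theorem4p7 : (n : ℕ) → 1 ≤ n →
    + a n ≡ sumTo n (λ k → (+ (n C k)) * f (n ∸ k))
theorem4p7 n _ = trans (cong (+_) (a≡paths n)) (sym (sumTo-binomial n))
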